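{- Let $\mathcal{A}$ be a finite set of positive integers, let $w \leqslant z$ be real numbers, let $0 < m_0 \leqslant 1$, and let $m_1, m_2, m_3, m_4$ be real numbers with $(m_1, m_2) \in \mathcal{U}$ and $(m_3, m_4) \in \mathcal{U}$. Writing $N^r_5 = \sum_{0 \leqslant i_1 < \cdots < i_r \leqslant 4} m_{i_1}\cdots m_{i_r}$ and $Q = m_0m_1m_2m_3m_4$, we have $$ S(\mathcal{A}, z) \geqslant S(\mathcal{A}, w) - \frac{N^4_5 - N^3_5 + N^2_5 - N^1_5 + 1}{Q} \sum_{w \leqslant p_1 < z} S(\mathcal{A}_{p_1}, w) + \frac{2(N^3_5 - 3N^2_5 + 7N^1_5 - 15)}{Q} \sum_{w \leqslant p_2 < p_1 < z} S(\mathcal{A}_{p_1p_2}, w) $$ $$ - \frac{6(N^2_5 - 6N^1_5 + 25)}{Q} \sum_{w \leqslant p_3 < p_2 < p_1 < z} S(\mathcal{A}_{p_1p_2p_3}, w) + \frac{24(N^1_5 - 10)}{Q} \sum_{w \leqslant p_4 < \cdots < p_1 < z} S(\mathcal{A}_{p_1p_2p_3p_4}, w) - \frac{120}{Q} \sum_{w \leqslant p_5 < \cdots < p_1 < z} S(\mathcal{A}_{p_1\cdots p_5}, w). $$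
   Context: Throughout, $p, p_1, p_2, \dots$ denote prime numbers. For a finite set $\mathcal{A}$ of positive integers and a positive integer $d$, $\mathcal{A}_d = \{a : ad \in \mathcal{A}\}$. For real $z$, $S(\mathcal{A}, z)$ denotes the number of $a \in \mathcal{A}$ having no prime factor less than $z$. Let $T = (0,1] \cup [2,3] \cup [4,5] \cup \cdots$, i.e. $T$ is the union of $(0,1]$ and the intervals $[k-1,k]$ over all odd integers $k \geqslant 3$, and let $\mathcal{U} = \{(x_1, x_2) : x_1, x_2 \in T,\ |x_1 - x_2| \leqslant 1\}$. -}

module Defs where

open import Axiom.ExcludedMiddle using (ExcludedMiddle)
open import Data.Empty using (⊥-elim)
open import Data.Integer.Base as ℤ using (+_)
import Data.Integer.Properties as ℤ
open import Data.List.Base using (List; []; _∷_; _++_; map; foldr; filter; length; upTo)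
open import Data.List.Extrema.Nat using (max; xs≤max)
open import Data.List.Membership.Propositional using (_∈_)
import Data.List.Membership.DecPropositional as DecMembership
open import Data.List.Membership.Propositional.Properties using
  (∈-filter⁺; ∈-filter⁻; ∈-map⁺; ∈-map⁻; ∈-upTo⁺)
import Data.List.Relation.Unary.All as All
open import Data.Nat.Base as ℕ using (ℕ; zero; suc)
open import Data.Nat.Divisibility using (_∣_)
open import Data.Nat.ListAction using (sum; product)
open import Data.Nat.Primality using (Prime)
import Data.Nat.Properties as ℕ
open import Data.Product.Base using (∃-syntax; _×_; _,_; proj₁; proj₂)
open import Data.Rational.Base as ℚ using (ℚ; 0ℚ; 1ℚ; ½; *<*)
open import Data.Rational.Literals using (fromℤ)
import Data.Rational.Properties as ℚ
open import Data.Rational.Solver using (module +-*-Solver)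
open import Data.Sum.Base using (_⊎_; inj₁; inj₂)
open import Function.Bundles using (_⇔_; mk⇔)
open import Level using (0ℓ)
open import Relation.Binary.PropositionalEquality using
  (_≡_; refl; sym; trans; cong; cong₂; subst; subst₂; module ≡-Reasoning)
open import Relation.Nullary using (¬_; yes; no)

module ℚ-Facts where

  ½-pos : ∀ {ε} → 0ℚ ℚ.< ε → 0ℚ ℚ.< ½ ℚ.* ε
  ½-pos {ε} ε>0 = subst (ℚ._< ½ ℚ.* ε) (ℚ.*-zeroʳ ½) (ℚ.*-monoʳ-<-pos ½ ε>0)

  half+half : ∀ ε → ½ ℚ.* ε ℚ.+ ½ ℚ.* ε ≡ ε
  half+half ε = trans (sym (ℚ.*-distribʳ-+ ε ½ ½)) (ℚ.*-identityˡ ε)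

  *-pos : ∀ {p q} → 0ℚ ℚ.< p → 0ℚ ℚ.< q → 0ℚ ℚ.< p ℚ.* q
  *-pos {p} {q} p>0 q>0 =
    ℚ.positive⁻¹ _ {{ℚ.pos*pos⇒pos p {{ℚ.positive p>0}} q {{ℚ.positive q>0}}}}

  ∣-∣-sym : ∀ p q → ℚ.∣ p ℚ.- q ∣ ≡ ℚ.∣ q ℚ.- p ∣
  ∣-∣-sym p q = trans (sym (ℚ.∣-p∣≡∣p∣ (p ℚ.- q)))
    (cong ℚ.∣_∣ (solve 2 (λ a b → :- (a :- b) := b :- a) refl p q))
    where open +-*-Solver

  p≤∣p∣ : ∀ p → p ℚ.≤ ℚ.∣ p ∣
  p≤∣p∣ p with ℚ.≤-total 0ℚ p
  ... | inj₁ 0≤p = ℚ.≤-reflexive (sym (ℚ.0≤p⇒∣p∣≡p 0≤p))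
  ... | inj₂ p≤0 = ℚ.≤-trans p≤0 (ℚ.0≤∣p∣ p)

  ∣p∣≤∣p-q∣+∣q∣ : ∀ p q → ℚ.∣ p ∣ ℚ.≤ ℚ.∣ p ℚ.- q ∣ ℚ.+ ℚ.∣ q ∣
  ∣p∣≤∣p-q∣+∣q∣ p q = subst (λ r → ℚ.∣ r ∣ ℚ.≤ ℚ.∣ p ℚ.- q ∣ ℚ.+ ℚ.∣ q ∣)
    (solve 2 (λ a b → (a :- b) :+ b := a) refl p q) (ℚ.∣p+q∣≤∣p∣+∣q∣ (p ℚ.- q) q)
    where open +-*-Solver

  ∣∣p∣-∣q∣∣≤∣p-q∣ : ∀ p q → ℚ.∣ ℚ.∣ p ∣ ℚ.- ℚ.∣ q ∣ ∣ ℚ.≤ ℚ.∣ p ℚ.- q ∣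
  ∣∣p∣-∣q∣∣≤∣p-q∣ p q with ℚ.∣p∣≡p∨∣p∣≡-p (ℚ.∣ p ∣ ℚ.- ℚ.∣ q ∣)
  ... | inj₁ eq = subst (ℚ._≤ ℚ.∣ p ℚ.- q ∣) (sym eq) (half p q)
    where
    open +-*-Solver
    half : ∀ p q → ℚ.∣ p ∣ ℚ.- ℚ.∣ q ∣ ℚ.≤ ℚ.∣ p ℚ.- q ∣
    half p q = subst (ℚ.∣ p ∣ ℚ.- ℚ.∣ q ∣ ℚ.≤_)
      (solve 2 (λ a b → (a :+ b) :- b := a) refl ℚ.∣ p ℚ.- q ∣ ℚ.∣ q ∣)
      (ℚ.+-monoˡ-≤ (ℚ.- ℚ.∣ q ∣) (∣p∣≤∣p-q∣+∣q∣ p q))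
  ... | inj₂ eq = subst (ℚ._≤ ℚ.∣ p ℚ.- q ∣) (sym eq)
    (subst₂ ℚ._≤_
      (solve 2 (λ a b → b :- a := :- (a :- b)) refl ℚ.∣ p ∣ ℚ.∣ q ∣)
      (trans (solve 2 (λ a b → (a :+ b) :- b := a) refl ℚ.∣ q ℚ.- p ∣ ℚ.∣ p ∣) (∣-∣-sym q p))
      (ℚ.+-monoˡ-≤ (ℚ.- ℚ.∣ p ∣) (∣p∣≤∣p-q∣+∣q∣ q p)))
    where open +-*-Solver

  *-mono-≤ : ∀ {p q r s} → 0ℚ ℚ.≤ r → 0ℚ ℚ.≤ q →
             p ℚ.≤ q → r ℚ.≤ s → p ℚ.* r ℚ.≤ q ℚ.* s
  *-mono-≤ {q = q} {r} 0≤r 0≤q p≤q r≤s = ℚ.≤-trans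
    (ℚ.*-monoʳ-≤-nonNeg r {{ℚ.nonNegative 0≤r}} p≤q)
    (ℚ.*-monoˡ-≤-nonNeg q {{ℚ.nonNegative 0≤q}} r≤s)

  -- The reciprocal, totalised by 0 ↦ 0.
  inv : ℚ → ℚ
  inv q with q ℚ.≟ 0ℚ
  ... | yes _   = 0ℚ
  ... | no  q≢0 = ℚ.1/_ q {{ℚ.≢-nonZero q≢0}}

  inv-inverse : ∀ {q} → 0ℚ ℚ.< q → q ℚ.* inv q ≡ 1ℚ
  inv-inverse {q} q>0 with q ℚ.≟ 0ℚ
  ... | yes q≡0 = ⊥-elim (ℚ.<⇒≢ q>0 (sym q≡0))
  ... | no  q≢0 = ℚ.*-inverseʳ q {{ℚ.≢-nonZero q≢0}}

  inv-pos : ∀ {q} → 0ℚ ℚ.< q → 0ℚ ℚ.< inv q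
  inv-pos {q} q>0 with q ℚ.≟ 0ℚ
  ... | yes q≡0 = ⊥-elim (ℚ.<⇒≢ q>0 (sym q≡0))
  ... | no  q≢0 = ℚ.positive⁻¹ _ {{ℚ.1/pos⇒pos q {{ℚ.positive q>0}}}}

  inv-antimono : ∀ {p q} → 0ℚ ℚ.< p → p ℚ.≤ q → inv q ℚ.≤ inv p
  inv-antimono {p} {q} p>0 p≤q = subst₂ ℚ._≤_
    (trans (solve 3 (λ a b c → (a :* b) :* c := (a :* c) :* b) refl p (inv q) (inv p))
      (trans (cong (ℚ._* inv q) (inv-inverse p>0)) (ℚ.*-identityˡ _)))
    (trans (cong (ℚ._* inv p) (inv-inverse q>0)) (ℚ.*-identityˡ _))
    (ℚ.*-monoʳ-≤-nonNeg (inv p) {{ℚ.nonNegative (ℚ.<⇒≤ (inv-pos p>0))}}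
      (ℚ.*-monoʳ-≤-nonNeg (inv q) {{ℚ.nonNegative (ℚ.<⇒≤ (inv-pos q>0))}} p≤q))
    where
    open +-*-Solver
    q>0 : 0ℚ ℚ.< q
    q>0 = ℚ.<-≤-trans p>0 p≤q

  inv-diff : ∀ {p q} → 0ℚ ℚ.< p → 0ℚ ℚ.< q →
             inv p ℚ.- inv q ≡ (inv p ℚ.* inv q) ℚ.* (q ℚ.- p)
  inv-diff {p} {q} p>0 q>0 = begin
    inv p ℚ.- inv q
      ≡⟨ cong₂ ℚ._-_ (sym (ℚ.*-identityʳ (inv p))) (sym (ℚ.*-identityʳ (inv q))) ⟩
    inv p ℚ.* 1ℚ ℚ.- inv q ℚ.* 1ℚ
      ≡⟨ cong₂ (λ a b → inv p ℚ.* a ℚ.- inv q ℚ.* b) (sym (inv-inverse q>0)) (sym (inv-inverse p>0)) ⟩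
    inv p ℚ.* (q ℚ.* inv q) ℚ.- inv q ℚ.* (p ℚ.* inv p)
      ≡⟨ solve 4 (λ a b c d → c :* (b :* d) :- d :* (a :* c) := (c :* d) :* (b :- a)) refl p q (inv p) (inv q) ⟩
    (inv p ℚ.* inv q) ℚ.* (q ℚ.- p) ∎
    where
    open ≡-Reasoning
    open +-*-Solver

  *-diff : ∀ a b c d → a ℚ.* b ℚ.- c ℚ.* d ≡ a ℚ.* (b ℚ.- d) ℚ.+ d ℚ.* (a ℚ.- c)
  *-diff = solve 4 (λ a b c d → a :* b :- c :* d := a :* (b :- d) :+ d :* (a :- c)) refl
    where open +-*-Solver

  inv-cancel : ∀ {D} e → 0ℚ ℚ.< D → D ℚ.* (inv D ℚ.* e) ≡ e
  inv-cancel {D} e D>0 = trans (sym (ℚ.*-assoc D (inv D) e))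
    (trans (cong (ℚ._* e) (inv-inverse D>0)) (ℚ.*-identityˡ e))

  *-close : ∀ {a b c d B C ε} → 0ℚ ℚ.< B → 0ℚ ℚ.< C →
            ℚ.∣ a ∣ ℚ.≤ B → ℚ.∣ d ∣ ℚ.≤ C →
            ℚ.∣ b ℚ.- d ∣ ℚ.< inv B ℚ.* (½ ℚ.* ε) →
            ℚ.∣ a ℚ.- c ∣ ℚ.< inv C ℚ.* (½ ℚ.* ε) →
            ℚ.∣ a ℚ.* b ℚ.- c ℚ.* d ∣ ℚ.< ε
  *-close {a} {b} {c} {d} {B} {C} {ε} B>0 C>0 a≤B d≤C b-d a-c = begin-strict
    ℚ.∣ a ℚ.* b ℚ.- c ℚ.* d ∣
      ≡⟨ cong ℚ.∣_∣ (*-diff a b c d) ⟩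
    ℚ.∣ a ℚ.* (b ℚ.- d) ℚ.+ d ℚ.* (a ℚ.- c) ∣
      ≤⟨ ℚ.∣p+q∣≤∣p∣+∣q∣ (a ℚ.* (b ℚ.- d)) (d ℚ.* (a ℚ.- c)) ⟩
    ℚ.∣ a ℚ.* (b ℚ.- d) ∣ ℚ.+ ℚ.∣ d ℚ.* (a ℚ.- c) ∣
      ≡⟨ cong₂ ℚ._+_ (ℚ.∣p*q∣≡∣p∣*∣q∣ a (b ℚ.- d)) (ℚ.∣p*q∣≡∣p∣*∣q∣ d (a ℚ.- c)) ⟩
    ℚ.∣ a ∣ ℚ.* ℚ.∣ b ℚ.- d ∣ ℚ.+ ℚ.∣ d ∣ ℚ.* ℚ.∣ a ℚ.- c ∣
      ≤⟨ ℚ.+-mono-≤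
           (ℚ.*-monoʳ-≤-nonNeg ℚ.∣ b ℚ.- d ∣ {{ℚ.∣-∣-nonNeg (b ℚ.- d)}} a≤B)
           (ℚ.*-monoʳ-≤-nonNeg ℚ.∣ a ℚ.- c ∣ {{ℚ.∣-∣-nonNeg (a ℚ.- c)}} d≤C) ⟩
    B ℚ.* ℚ.∣ b ℚ.- d ∣ ℚ.+ C ℚ.* ℚ.∣ a ℚ.- c ∣
      <⟨ ℚ.+-mono-<
           (ℚ.*-monoʳ-<-pos B {{ℚ.positive B>0}} b-d)
           (ℚ.*-monoʳ-<-pos C {{ℚ.positive C>0}} a-c) ⟩
    B ℚ.* (inv B ℚ.* (½ ℚ.* ε)) ℚ.+ C ℚ.* (inv C ℚ.* (½ ℚ.* ε))
      ≡⟨ cong₂ ℚ._+_ (inv-cancel (½ ℚ.* ε) B>0) (inv-cancel (½ ℚ.* ε) C>0) ⟩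
    ½ ℚ.* ε ℚ.+ ½ ℚ.* ε
      ≡⟨ half+half ε ⟩
    ε ∎
    where open ℚ.≤-Reasoning

  inv-close : ∀ {a b δ ε} → 0ℚ ℚ.< δ → δ ℚ.≤ a → δ ℚ.≤ b →
              ℚ.∣ b ℚ.- a ∣ ℚ.< δ ℚ.* (δ ℚ.* ε) → ℚ.∣ inv a ℚ.- inv b ∣ ℚ.< ε
  inv-close {a} {b} {δ} {ε} δ>0 δ≤a δ≤b b-a = begin-strict
    ℚ.∣ inv a ℚ.- inv b ∣
      ≡⟨ cong ℚ.∣_∣ (inv-diff a>0 b>0) ⟩
    ℚ.∣ (inv a ℚ.* inv b) ℚ.* (b ℚ.- a) ∣
      ≡⟨ ℚ.∣p*q∣≡∣p∣*∣q∣ (inv a ℚ.* inv b) (b ℚ.- a) ⟩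
    ℚ.∣ inv a ℚ.* inv b ∣ ℚ.* ℚ.∣ b ℚ.- a ∣
      ≡⟨ cong (ℚ._* ℚ.∣ b ℚ.- a ∣) (ℚ.0≤p⇒∣p∣≡p (ℚ.<⇒≤ (*-pos (inv-pos a>0) (inv-pos b>0)))) ⟩
    (inv a ℚ.* inv b) ℚ.* ℚ.∣ b ℚ.- a ∣
      ≤⟨ ℚ.*-monoʳ-≤-nonNeg ℚ.∣ b ℚ.- a ∣ {{ℚ.∣-∣-nonNeg (b ℚ.- a)}}
           (*-mono-≤ (ℚ.<⇒≤ (inv-pos b>0)) (ℚ.<⇒≤ (inv-pos δ>0))
             (inv-antimono δ>0 δ≤a) (inv-antimono δ>0 δ≤b)) ⟩
    (inv δ ℚ.* inv δ) ℚ.* ℚ.∣ b ℚ.- a ∣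
      <⟨ ℚ.*-monoʳ-<-pos (inv δ ℚ.* inv δ)
           {{ℚ.positive (*-pos (inv-pos δ>0) (inv-pos δ>0))}} b-a ⟩
    (inv δ ℚ.* inv δ) ℚ.* (δ ℚ.* (δ ℚ.* ε))
      ≡⟨ rearrange δ (inv δ) ε ⟩
    δ ℚ.* (inv δ ℚ.* (δ ℚ.* (inv δ ℚ.* ε)))
      ≡⟨ inv-cancel _ δ>0 ⟩
    δ ℚ.* (inv δ ℚ.* ε)
      ≡⟨ inv-cancel ε δ>0 ⟩
    ε ∎
    where
    open ℚ.≤-Reasoning
    a>0 = ℚ.<-≤-trans δ>0 δ≤a
    b>0 = ℚ.<-≤-trans δ>0 δ≤b
    rearrange : ∀ d i e → (i ℚ.* i) ℚ.* (d ℚ.* (d ℚ.* e)) ≡ d ℚ.* (i ℚ.* (d ℚ.* (i ℚ.* e)))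
    rearrange = solve 3 (λ d i e → (i :* i) :* (d :* (d :* e)) := d :* (i :* (d :* (i :* e)))) refl
      where open +-*-Solver

open ℚ-Facts

-- Real numbers as Cauchy sequences of rationals. ℝ is a setoid whose
-- equality is x ≤ y × y ≤ x, for the order _≤_ below.

record ℝ : Set where
  constructor mkℝ
  field
    seq    : ℕ → ℚ
    cauchy : ∀ ε → 0ℚ ℚ.< ε → ∃[ N ] (∀ m n → N ℕ.≤ m → N ℕ.≤ n →
             ℚ.∣ seq m ℚ.- seq n ∣ ℚ.< ε)

open ℝ public

infix  4 _<_ _≤_
infixl 6 _+_ _-_
infixl 7 _*_

_<_ : ℝ → ℝ → Set
x < y = ∃[ ε ] (0ℚ ℚ.< ε × ∃[ N ] (∀ n → N ℕ.≤ n → seq x n ℚ.+ ε ℚ.≤ seq y n))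

_≤_ : ℝ → ℝ → Set
x ≤ y = ∀ ε → 0ℚ ℚ.< ε → ∃[ N ] (∀ n → N ℕ.≤ n → seq x n ℚ.≤ seq y n ℚ.+ ε)

fromℚ : ℚ → ℝ
fromℚ q .seq _ = q
fromℚ q .cauchy ε ε>0 = 0 , λ _ _ _ _ →
  subst (ℚ._< ε) (sym (cong ℚ.∣_∣ (ℚ.+-inverseʳ q))) ε>0

fromℕ : ℕ → ℝ
fromℕ n = fromℚ (fromℤ (+ n))

0ℝ 1ℝ : ℝ
0ℝ = fromℕ 0
1ℝ = fromℕ 1

_+_ : ℝ → ℝ → ℝ
(x + y) .seq n = seq x n ℚ.+ seq y n
(x + y) .cauchy ε ε>0 with cauchy x (½ ℚ.* ε) (½-pos ε>0) | cauchy y (½ ℚ.* ε) (½-pos ε>0)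
... | M , f | N , g = M ℕ.⊔ N , λ m n m≥ n≥ → begin-strict
  ℚ.∣ (seq x m ℚ.+ seq y m) ℚ.- (seq x n ℚ.+ seq y n) ∣
    ≡⟨ cong ℚ.∣_∣ (solve 4 (λ a b c d → (a :+ b) :- (c :+ d) := (a :- c) :+ (b :- d)) refl
         (seq x m) (seq y m) (seq x n) (seq y n)) ⟩
  ℚ.∣ (seq x m ℚ.- seq x n) ℚ.+ (seq y m ℚ.- seq y n) ∣
    ≤⟨ ℚ.∣p+q∣≤∣p∣+∣q∣ (seq x m ℚ.- seq x n) (seq y m ℚ.- seq y n) ⟩
  ℚ.∣ seq x m ℚ.- seq x n ∣ ℚ.+ ℚ.∣ seq y m ℚ.- seq y n ∣
    <⟨ ℚ.+-mono-< (f m n (ℕ.m⊔n≤o⇒m≤o M N m≥) (ℕ.m⊔n≤o⇒m≤o M N n≥))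
                  (g m n (ℕ.m⊔n≤o⇒n≤o M N m≥) (ℕ.m⊔n≤o⇒n≤o M N n≥)) ⟩
  ½ ℚ.* ε ℚ.+ ½ ℚ.* ε
    ≡⟨ half+half ε ⟩
  ε ∎
  where
  open ℚ.≤-Reasoning
  open +-*-Solver

-_ : ℝ → ℝ
(- x) .seq n = ℚ.- seq x n
(- x) .cauchy ε ε>0 with cauchy x ε ε>0
... | N , f = N , λ m n m≥ n≥ → subst (ℚ._< ε)
  (trans (∣-∣-sym (seq x m) (seq x n))
    (cong ℚ.∣_∣ (solve 2 (λ a b → b :- a := (:- a) :- (:- b)) refl (seq x m) (seq x n))))
  (f m n m≥ n≥)
  where open +-*-Solver

_-_ : ℝ → ℝ → ℝ
x - y = x + (- y)

∣_∣ : ℝ → ℝ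
∣ x ∣ .seq n = ℚ.∣ seq x n ∣
∣ x ∣ .cauchy ε ε>0 with cauchy x ε ε>0
... | N , f = N , λ m n m≥ n≥ →
  ℚ.≤-<-trans (∣∣p∣-∣q∣∣≤∣p-q∣ (seq x m) (seq x n)) (f m n m≥ n≥)

Bounded : ℝ → Set
Bounded x = ∃[ B ] (0ℚ ℚ.< B × ∃[ N ] (∀ n → N ℕ.≤ n → ℚ.∣ seq x n ∣ ℚ.≤ B))

bounded : ∀ x → Bounded x
bounded x =
  let N , f = cauchy x 1ℚ (ℚ.positive⁻¹ 1ℚ)
  in 1ℚ ℚ.+ ℚ.∣ seq x N ∣
    , ℚ.+-mono-<-≤ (ℚ.positive⁻¹ 1ℚ) (ℚ.0≤∣p∣ (seq x N))
    , N , λ n n≥ → ℚ.≤-trans (∣p∣≤∣p-q∣+∣q∣ (seq x n) (seq x N))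
        (ℚ.+-monoˡ-≤ ℚ.∣ seq x N ∣ (ℚ.<⇒≤ (f n N n≥ ℕ.≤-refl)))

_*_ : ℝ → ℝ → ℝ
(x * y) .seq n = seq x n ℚ.* seq y n
(x * y) .cauchy ε ε>0 = go (bounded x) (bounded y)
  where
  go : Bounded x → Bounded y → ∃[ N ] (∀ m n → N ℕ.≤ m → N ℕ.≤ n →
       ℚ.∣ seq x m ℚ.* seq y m ℚ.- seq x n ℚ.* seq y n ∣ ℚ.< ε)
  go (B , B>0 , K , b) (C , C>0 , L , c) =
    let M , f = cauchy x (inv C ℚ.* (½ ℚ.* ε)) (*-pos (inv-pos C>0) (½-pos ε>0))
        N , g = cauchy y (inv B ℚ.* (½ ℚ.* ε)) (*-pos (inv-pos B>0) (½-pos ε>0))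
    in (K ℕ.⊔ L) ℕ.⊔ (M ℕ.⊔ N) , λ m n m≥ n≥ →
      let K≤m  = ℕ.m⊔n≤o⇒m≤o K L (ℕ.m⊔n≤o⇒m≤o (K ℕ.⊔ L) (M ℕ.⊔ N) m≥)
          L≤n  = ℕ.m⊔n≤o⇒n≤o K L (ℕ.m⊔n≤o⇒m≤o (K ℕ.⊔ L) (M ℕ.⊔ N) n≥)
          MN≤m = ℕ.m⊔n≤o⇒n≤o (K ℕ.⊔ L) (M ℕ.⊔ N) m≥
          MN≤n = ℕ.m⊔n≤o⇒n≤o (K ℕ.⊔ L) (M ℕ.⊔ N) n≥
      in *-close {seq x m} {seq y m} {seq x n} {seq y n} {B} {C} {ε}
           B>0 C>0 (b m K≤m) (c n L≤n)
           (g m n (ℕ.m⊔n≤o⇒n≤o M N MN≤m) (ℕ.m⊔n≤o⇒n≤o M N MN≤n))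
           (f m n (ℕ.m⊔n≤o⇒m≤o M N MN≤m) (ℕ.m⊔n≤o⇒m≤o M N MN≤n))

recip : (x : ℝ) → 0ℝ < x → ℝ
recip x x>0 .seq n = inv (seq x n)
recip x (δ , δ>0 , K , δ≤) .cauchy ε ε>0
  with cauchy x (δ ℚ.* (δ ℚ.* ε)) (*-pos δ>0 (*-pos δ>0 ε>0))
... | N , f = K ℕ.⊔ N , λ m n m≥ n≥ →
  inv-close {seq x m} {seq x n} δ>0 (lower m (ℕ.m⊔n≤o⇒m≤o K N m≥)) (lower n (ℕ.m⊔n≤o⇒m≤o K N n≥))
    (f n m (ℕ.m⊔n≤o⇒n≤o K N n≥) (ℕ.m⊔n≤o⇒n≤o K N m≥))
  where
  lower : ∀ n → K ℕ.≤ n → δ ℚ.≤ seq x n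
  lower n K≤n = subst (ℚ._≤ seq x n) (ℚ.+-identityˡ δ) (δ≤ n K≤n)

<-≤-trans : ∀ {x y z} → x < y → y ≤ z → x < z
<-≤-trans {x} {y} {z} (ε , ε>0 , M , f) y≤z with y≤z (½ ℚ.* ε) (½-pos ε>0)
... | N , g = ½ ℚ.* ε , ½-pos ε>0 , M ℕ.⊔ N , λ n n≥ →
  subst₂ ℚ._≤_
    (trans (cong (λ e → (seq x n ℚ.+ e) ℚ.- ½ ℚ.* ε) (sym (half+half ε)))
      (solve 2 (λ a h → (a :+ (h :+ h)) :- h := a :+ h) refl (seq x n) (½ ℚ.* ε)))
    (solve 2 (λ c h → (c :+ h) :- h := c) refl (seq z n) (½ ℚ.* ε))
    (ℚ.+-monoˡ-≤ (ℚ.- (½ ℚ.* ε))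
      (ℚ.≤-trans (f n (ℕ.m⊔n≤o⇒m≤o M N n≥)) (g n (ℕ.m⊔n≤o⇒n≤o M N n≥))))
  where open +-*-Solver

*-positive : ∀ {x y} → 0ℝ < x → 0ℝ < y → 0ℝ < x * y
*-positive {x} {y} (δ , δ>0 , M , f) (ε , ε>0 , N , g) =
  δ ℚ.* ε , *-pos δ>0 ε>0 , M ℕ.⊔ N , λ n n≥ →
  subst (ℚ._≤ seq x n ℚ.* seq y n) (sym (ℚ.+-identityˡ (δ ℚ.* ε)))
    (*-mono-≤ (ℚ.<⇒≤ ε>0)
      (ℚ.≤-trans (ℚ.<⇒≤ δ>0) (drop δ (f n (ℕ.m⊔n≤o⇒m≤o M N n≥))))
      (drop δ (f n (ℕ.m⊔n≤o⇒m≤o M N n≥)))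
      (drop ε (g n (ℕ.m⊔n≤o⇒n≤o M N n≥))))
  where
  drop : ∀ p {q} → 0ℚ ℚ.+ p ℚ.≤ q → p ℚ.≤ q
  drop p {q} = subst (ℚ._≤ q) (ℚ.+-identityˡ p)

-- A natural number above x: the numerator of a positive rational above x.
bound : ℝ → ℕ
bound x = ℤ.∣ ℚ.↥ (proj₁ (bounded x)) ∣

fromℕ<⇒<bound : ∀ {n x} → fromℕ n < x → n ℕ.< bound x
fromℕ<⇒<bound {n} {x} (ε , ε>0 , M , f) = numerator-bound _ n<B
  where
  N : ℕ
  N = proj₁ (proj₂ (proj₂ (bounded x)))

  n<B : fromℤ (+ n) ℚ.< proj₁ (bounded x)
  n<B = begin-strict
    fromℤ (+ n)          ≡⟨ sym (ℚ.+-identityʳ _) ⟩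
    fromℤ (+ n) ℚ.+ 0ℚ   <⟨ ℚ.+-monoʳ-< (fromℤ (+ n)) ε>0 ⟩
    fromℤ (+ n) ℚ.+ ε    ≤⟨ f (M ℕ.⊔ N) (ℕ.m≤m⊔n M N) ⟩
    seq x (M ℕ.⊔ N)      ≤⟨ p≤∣p∣ _ ⟩
    ℚ.∣ seq x (M ℕ.⊔ N) ∣ ≤⟨ proj₂ (proj₂ (proj₂ (bounded x))) (M ℕ.⊔ N) (ℕ.m≤n⊔m M N) ⟩
    proj₁ (bounded x)    ∎
    where open ℚ.≤-Reasoning

  numerator-bound : ∀ q → fromℤ (+ n) ℚ.< q → n ℕ.< ℤ.∣ ℚ.↥ q ∣
  numerator-bound (ℚ.mkℚ (+ k) d _) (*<* lt) = ℕ.≤-<-trans (ℕ.m≤m*n n (suc d))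
    (subst (n ℕ.* suc d ℕ.<_) (ℕ.*-identityʳ k)
      (ℤ.drop‿+<+ (subst₂ ℤ._<_ (sym (ℤ.pos-* n (suc d))) (sym (ℤ.pos-* k 1)) lt)))
  numerator-bound (ℚ.mkℚ ℤ.-[1+ k ] d _) (*<* lt)
    with subst (ℤ._< _) (sym (ℤ.pos-* n (suc d))) lt
  ... | ()

-- The sublists of length r; for xs = x₀ ∷ ⋯ ∷ xₙ₋₁ these are the lists
-- xᵢ₁ ∷ ⋯ ∷ xᵢᵣ with i₁ < ⋯ < iᵣ, each index tuple occurring once.
choose : ∀ {A : Set} → ℕ → List A → List (List A)
choose zero    xs       = [] ∷ []
choose (suc r) []       = []
choose (suc r) (x ∷ xs) = map (x ∷_) (choose r xs) ++ choose (suc r) xs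

sumℝ productℝ : List ℝ → ℝ
sumℝ     = foldr _+_ 0ℝ
productℝ = foldr _*_ 1ℝ

N^ : ℕ → List ℝ → ℝ
N^ r ms = sumℝ (map productℝ (choose r ms))

T : ℝ → Set
T x = (0ℝ < x × x ≤ 1ℝ)
    ⊎ ∃[ k ] (3 ℕ.≤ k × ¬ (2 ∣ k) × fromℕ k - 1ℝ ≤ x × x ≤ fromℕ k)

𝒰 : ℝ → ℝ → Set
𝒰 x₁ x₂ = T x₁ × T x₂ × ∣ x₁ - x₂ ∣ ≤ 1ℝ

T⇒positive : ∀ {x} → T x → 0ℝ < x
T⇒positive (inj₁ (0<x , _)) = 0<x
T⇒positive {x} (inj₂ (k , 3≤k , _ , k-1≤x , _)) = <-≤-trans {0ℝ} {fromℕ k - 1ℝ} {x}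
  (1ℚ , ℚ.positive⁻¹ 1ℚ , 0 , λ _ _ → 1≤k-1) k-1≤x
  where
  1≤k-1 : 0ℚ ℚ.+ 1ℚ ℚ.≤ fromℤ (+ k) ℚ.- 1ℚ
  1≤k-1 = ℚ.+-monoˡ-≤ (ℚ.- 1ℚ) {fromℤ (+ 2)} {fromℤ (+ k)}
    (ℚ.*≤* (ℤ.*-monoʳ-≤-nonNeg (+ 1) (ℤ.+≤+ (ℕ.≤-trans (ℕ.n≤1+n 2) 3≤k))))

Q-positive : ∀ {m₀ m₁ m₂ m₃ m₄} → 0ℝ < m₀ → 𝒰 m₁ m₂ → 𝒰 m₃ m₄ →
             0ℝ < m₀ * m₁ * m₂ * m₃ * m₄
Q-positive {m₀} {m₁} {m₂} {m₃} {m₄} m₀>0 (t₁ , t₂ , _) (t₃ , t₄ , _) =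
  *-positive {m₀ * m₁ * m₂ * m₃} {m₄}
    (*-positive {m₀ * m₁ * m₂} {m₃}
      (*-positive {m₀ * m₁} {m₂}
        (*-positive {m₀} {m₁} m₀>0 (T⇒positive {m₁} t₁))
        (T⇒positive {m₂} t₂))
      (T⇒positive {m₃} t₃))
    (T⇒positive {m₄} t₄)

-- A finite set of positive integers is given as a list of
-- positive naturals without repetitions.

open DecMembership ℕ._≟_ using (_∈?_)

-- { a : a d ∈ 𝒜 } for d ≥ 1; then a d ∈ 𝒜 forces a ≤ max 𝒜, so it is enough
-- to search 1, …, max 𝒜.
_÷_ : List ℕ → ℕ → List ℕ
𝒜 ÷ d = filter (λ a → a ℕ.* d ∈? 𝒜) (map suc (upTo (max 0 𝒜)))

∈-÷ : ∀ {𝒜 d a} .{{_ : ℕ.NonZero d}} → a ∈ 𝒜 ÷ d ⇔ (0 ℕ.< a × a ℕ.* d ∈ 𝒜)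
∈-÷ {𝒜} {d} {a} = mk⇔ to from
  where
  dec = λ b → b ℕ.* d ∈? 𝒜

  to : a ∈ 𝒜 ÷ d → 0 ℕ.< a × a ℕ.* d ∈ 𝒜
  to a∈ with ∈-filter⁻ dec {xs = map suc (upTo (max 0 𝒜))} a∈
  ... | a∈′ , ad∈ with ∈-map⁻ suc a∈′
  ... | _ , _ , refl = ℕ.z<s , ad∈

  from : 0 ℕ.< a × a ℕ.* d ∈ 𝒜 → a ∈ 𝒜 ÷ d
  from (ℕ.s≤s _ , ad∈) = ∈-filter⁺ dec
    (∈-map⁺ suc (∈-upTo⁺ (ℕ.≤-trans (ℕ.m≤m*n a d) (All.lookup (xs≤max 0 𝒜) ad∈)))) ad∈

-- Comparing a real number with a natural number is not decidable
-- constructively, so the counting below is done with excluded middle.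
module Sieve (em : ExcludedMiddle 0ℓ) where

  S : List ℕ → ℝ → ℕ
  S 𝒜 z = length (filter (λ a → em {¬ (∃[ p ] (Prime p × p ∣ a × fromℕ p < z))}) 𝒜)

  primes[_,_⟩ : ℝ → ℝ → List ℕ
  primes[ w , z ⟩ =
    filter (λ p → em {Prime p × w ≤ fromℕ p × fromℕ p < z}) (upTo (bound z))

  ∈-primes : ∀ {w z p} →
             p ∈ primes[ w , z ⟩ ⇔ (Prime p × w ≤ fromℕ p × fromℕ p < z)
  ∈-primes {w} {z} {p} = mk⇔
    (λ p∈ → proj₂ (∈-filter⁻ (λ _ → em) {xs = upTo (bound z)} p∈))
    (λ h → ∈-filter⁺ (λ _ → em) (∈-upTo⁺ (fromℕ<⇒<bound {p} {z} (proj₂ (proj₂ h)))) h)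

  -- ∑ S(𝒜_{p₁⋯pᵣ}, w) over primes w ≤ pᵣ < ⋯ < p₁ < z.
  ∑S : ℕ → List ℕ → ℝ → ℝ → ℕ
  ∑S r 𝒜 w z = sum (map (λ ps → S (𝒜 ÷ product ps) w) (choose r primes[ w , z ⟩))

{-# OPTIONS --safe #-}
module Submission where

-- Let b ∈ 𝒜 have no prime factor below w, and let n be the number of primes
-- p ∣ b with w ≤ p < z. In the r-th sum of the theorem b is counted once for each
-- r-subset of these primes, so its total contribution to the left-hand side is
-- a combination of the binomial coefficients n C r; converting powers of n to
-- binomial coefficients identifies it with Π (mᵢ - n) / Q. This is 1 for n = 0
-- and ≤ 0 for n ≥ 1: then m₀ ≤ n, and no integer lies strictly between m₁ and m₂,
-- or between m₃ and m₄, because the components of T and the gaps between them are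
-- unit intervals with integer endpoints. So the left-hand side is at most the
-- number of b with n = 0, which is S(𝒜, z).

open import Defs
open import Axiom.ExcludedMiddle using (ExcludedMiddle)
open import Data.Empty using (⊥-elim)
open import Data.Integer.Base as ℤ using (+_)
import Data.Integer.Properties as ℤ
open import Data.List.Base using (List; []; _∷_; _++_; map; foldr; filter; length)
open import Data.List.Extrema.Nat using (max)
import Data.List.Membership.DecPropositional as DecMembership
open import Data.List.Membership.Propositional using (_∈_)
open import Data.List.Membership.Propositional.Properties using
  (∈-filter⁺; ∈-filter⁻; ∈-map⁺; ∈-map⁻; ∈-++⁻)
open import Data.List.Membership.Propositional.Properties.WithK using (unique∧set⇒bag)
open import Data.List.Properties using
  (length-map; length-++; filter-++; filter-accept; filter-reject; filter-none)
open import Data.List.Relation.Binary.BagAndSetEquality using (∼bag⇒↭)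
open import Data.List.Relation.Binary.Permutation.Propositional.Properties using (↭-length)
open import Data.List.Relation.Binary.Sublist.Propositional using (_⊆_; []; _∷_; _∷ʳ_; minimum)
open import Data.List.Relation.Binary.Sublist.Propositional.Properties using (All-resp-⊆)
open import Data.List.Relation.Unary.All as All using (All; []; _∷_; all?)
open import Data.List.Relation.Unary.AllPairs using ([]; _∷_)
open import Data.List.Relation.Unary.Any using (here; there)
open import Data.List.Relation.Unary.Unique.Propositional using (Unique)
import Data.List.Relation.Unary.Unique.Propositional.Properties as Unique
open import Data.Nat.Base as ℕ using (ℕ; zero; suc)
open import Data.Nat.Combinatorics using (_C_; nC1≡n; nCk+nC[k+1]≡[n+1]C[k+1])
open import Data.Nat.Divisibility using
  (_∣_; _∣?_; divides; 1∣_; ∣-trans; ∣m⇒∣m*n; m∣m*n; n∣m*n)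
open import Data.Nat.ListAction using (sum; product)
open import Data.Nat.Primality using (Prime; euclidsLemma; productOfPrimes≢0)
open import Data.Nat.Primality.Factorisation using (factorisationHasAllPrimeFactors)
import Data.Nat.Properties as ℕ
import Data.Nat.Solver as ℕ
open import Data.Product.Base using (∃-syntax; _×_; _,_; proj₁; proj₂; swap)
open import Data.Rational.Base as ℚ using (ℚ; 0ℚ; 1ℚ; ½)
open import Data.Rational.Literals using (fromℤ)
import Data.Rational.Properties as ℚ
open import Data.Rational.Solver using (module +-*-Solver)
import Data.Rational.Unnormalised.Base as ℚᵘ
import Data.Rational.Unnormalised.Properties as ℚᵘ
open import Data.Sum.Base as Sum using (_⊎_; inj₁; inj₂)
open import Function.Base using (_∘_)
open import Function.Bundles using (mk⇔; Equivalence)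
open import Level using (0ℓ)
open import Relation.Binary.PropositionalEquality using
  (_≡_; refl; sym; trans; cong; cong₂; subst; subst₂; module ≡-Reasoning)
open import Relation.Nullary using (¬_; Dec; yes; no)
open import Relation.Unary using (Pred; Decidable)

open ℚ-Facts
open DecMembership ℕ._≟_ using (_∈?_)

-- The embedding of the naturals in the rationals

ι : ℕ → ℚ
ι n = fromℤ (+ n)

ι-mono : ∀ {m n} → m ℕ.≤ n → ι m ℚ.≤ ι n
ι-mono m≤n = ℚ.*≤* (ℤ.*-monoʳ-≤-nonNeg (+ 1) (ℤ.+≤+ m≤n))

ι-+ : ∀ m n → ι (m ℕ.+ n) ≡ ι m ℚ.+ ι n
ι-+ m n = ℚ.toℚᵘ-injective (ℚᵘ.≃-trans
  (ℚᵘ.*≡* (cong (ℤ._* + 1) (trans (ℤ.pos-+ m n)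
    (sym (cong₂ ℤ._+_ (ℤ.*-identityʳ (+ m)) (ℤ.*-identityʳ (+ n)))))))
  (ℚᵘ.≃-sym (ℚ.toℚᵘ-homo-+ (ι m) (ι n))))

ι-* : ∀ m n → ι (m ℕ.* n) ≡ ι m ℚ.* ι n
ι-* m n = ℚ.toℚᵘ-injective (ℚᵘ.≃-trans
  (ℚᵘ.*≡* (cong (ℤ._* + 1) (ℤ.pos-* m n)))
  (ℚᵘ.≃-sym (ℚ.toℚᵘ-homo-* (ι m) (ι n))))

-- Order on ℝ

-- The tolerance ε of the hypothesis serves unchanged for the conclusion, so an inequality of reals
-- follows from another by rational algebra on the terms. Comparing differences allows terms to be
-- moved from one side to the other; `N` admits algebra that is valid only from some index on.
≤-shift : ∀ {u v x y} N →
          (∀ k → N ℕ.≤ k → seq u k ℚ.- seq v k ℚ.≤ seq x k ℚ.- seq y k) →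
          x ≤ y → u ≤ v
≤-shift {u} {v} {x} {y} N u-v≤x-y x≤y ε ε>0 with x≤y ε ε>0
... | M , f = N ℕ.⊔ M , λ k k≥ → subst₂ ℚ._≤_
  (solve 2 (λ u v → (u :- v) :+ v := u) refl (seq u k) (seq v k))
  (solve 3 (λ y v ε → (y :+ ε :- y) :+ v := v :+ ε) refl (seq y k) (seq v k) ε)
  (ℚ.+-monoˡ-≤ (seq v k) (ℚ.≤-trans (u-v≤x-y k (ℕ.m⊔n≤o⇒m≤o N M k≥))
    (ℚ.+-monoˡ-≤ (ℚ.- seq y k) (f k (ℕ.m⊔n≤o⇒n≤o N M k≥)))))
  where open +-*-Solver

≤-refl : ∀ {x} → x ≤ x
≤-refl {x} ε ε>0 = 0 , λ k _ → ℚ.≤-trans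
  (ℚ.≤-reflexive (sym (ℚ.+-identityʳ (seq x k)))) (ℚ.+-monoʳ-≤ (seq x k) (ℚ.<⇒≤ ε>0))

+-mono-≤ : ∀ {x y u v} → x ≤ y → u ≤ v → x + u ≤ y + v
+-mono-≤ {x} {y} {u} {v} x≤y u≤v ε ε>0
  with x≤y (½ ℚ.* ε) (½-pos ε>0) | u≤v (½ ℚ.* ε) (½-pos ε>0)
... | M , f | N , g = M ℕ.⊔ N , λ k k≥ →
  subst (seq x k ℚ.+ seq u k ℚ.≤_)
    (trans
      (solve 3 (λ y v h → (y :+ h) :+ (v :+ h) := (y :+ v) :+ (h :+ h)) refl
        (seq y k) (seq v k) (½ ℚ.* ε))
      (cong (seq y k ℚ.+ seq v k ℚ.+_) (half+half ε)))
    (ℚ.+-mono-≤ (f k (ℕ.m⊔n≤o⇒m≤o M N k≥)) (g k (ℕ.m⊔n≤o⇒n≤o M N k≥)))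
  where open +-*-Solver

<⇒≤ : ∀ {x y} → x < y → x ≤ y
<⇒≤ {x} {y} (δ , δ>0 , N , f) ε ε>0 = N , λ k k≥ → begin
  seq x k          ≡⟨ sym (ℚ.+-identityʳ (seq x k)) ⟩
  seq x k ℚ.+ 0ℚ   ≤⟨ ℚ.+-monoʳ-≤ (seq x k) (ℚ.<⇒≤ δ>0) ⟩
  seq x k ℚ.+ δ    ≤⟨ f k k≥ ⟩
  seq y k          ≡⟨ sym (ℚ.+-identityʳ (seq y k)) ⟩
  seq y k ℚ.+ 0ℚ   ≤⟨ ℚ.+-monoʳ-≤ (seq y k) (ℚ.<⇒≤ ε>0) ⟩
  seq y k ℚ.+ ε    ∎
  where open ℚ.≤-Reasoning

<-irrefl : ∀ {x} → ¬ x < x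
<-irrefl {x} (ε , ε>0 , N , f) = ℚ.<-irrefl refl (ℚ.<-≤-trans
  (subst (ℚ._< seq x N ℚ.+ ε) (ℚ.+-identityʳ (seq x N)) (ℚ.+-monoʳ-< (seq x N) ε>0))
  (f N ℕ.≤-refl))

-- A single term decides. Take `N` beyond which the terms of y - x vary by less than ε/2. If the
-- term at `N` is at most ε/2, all later ones are at most ε; otherwise they all exceed the positive
-- rational by which it surpasses ε/2, which witnesses x < y.
≮⇒≥ : ∀ {x y} → ¬ x < y → y ≤ x
≮⇒≥ {x} {y} x≮y ε ε>0 = go (cauchy (y - x) (½ ℚ.* ε) (½-pos ε>0))
  where
  open ℚ.≤-Reasoning
  open +-*-Solver

  upper : ∀ {d h} a b → ℚ.∣ (b ℚ.- a) ℚ.- d ∣ ℚ.< h → d ℚ.≤ h → b ℚ.≤ a ℚ.+ (h ℚ.+ h)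
  upper {d} {h} a b lt d≤h = begin
    b                                 ≡⟨ solve 3 (λ a b d → b := a :+ ((b :- a) :- d :+ d)) refl a b d ⟩
    a ℚ.+ ((b ℚ.- a) ℚ.- d ℚ.+ d)     ≤⟨ ℚ.+-monoʳ-≤ a (ℚ.+-mono-≤ (ℚ.≤-trans (p≤∣p∣ _) (ℚ.<⇒≤ lt)) d≤h) ⟩
    a ℚ.+ (h ℚ.+ h)                   ∎

  lower : ∀ {d h} a b → ℚ.∣ d ℚ.- (b ℚ.- a) ∣ ℚ.< h → a ℚ.+ (d ℚ.- h) ℚ.≤ b
  lower {d} {h} a b lt = begin
    a ℚ.+ (d ℚ.- h)                   ≡⟨ solve 4 (λ a b d h → a :+ (d :- h) := b :+ ((d :- (b :- a)) :- h)) refl a b d h ⟩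
    b ℚ.+ ((d ℚ.- (b ℚ.- a)) ℚ.- h)   ≤⟨ ℚ.+-monoʳ-≤ b (ℚ.+-monoˡ-≤ (ℚ.- h) (ℚ.≤-trans (p≤∣p∣ _) (ℚ.<⇒≤ lt))) ⟩
    b ℚ.+ (h ℚ.- h)                   ≡⟨ solve 2 (λ b h → b :+ (h :- h) := b) refl b h ⟩
    b                                 ∎

  pos : ∀ {d h} → h ℚ.< d → 0ℚ ℚ.< d ℚ.- h
  pos {d} {h} h<d = subst (ℚ._< d ℚ.- h) (ℚ.+-inverseʳ h) (ℚ.+-monoˡ-< (ℚ.- h) h<d)

  Close : ℕ → Set
  Close N = ∀ m n → N ℕ.≤ m → N ℕ.≤ n →
    ℚ.∣ (seq y m ℚ.- seq x m) ℚ.- (seq y n ℚ.- seq x n) ∣ ℚ.< ½ ℚ.* ε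

  split : ∀ N → Close N → Dec (seq y N ℚ.- seq x N ℚ.≤ ½ ℚ.* ε) →
          ∃[ M ] (∀ k → M ℕ.≤ k → seq y k ℚ.≤ seq x k ℚ.+ ε)
  split N close (yes d≤) = N , λ k k≥ → subst (λ e → seq y k ℚ.≤ seq x k ℚ.+ e) (half+half ε)
    (upper {seq y N ℚ.- seq x N} {½ ℚ.* ε} (seq x k) (seq y k) (close k N k≥ ℕ.≤-refl) d≤)
  split N close (no d≰) = ⊥-elim (x≮y (seq y N ℚ.- seq x N ℚ.- ½ ℚ.* ε , pos {seq y N ℚ.- seq x N} (ℚ.≰⇒> d≰) , N ,
    λ k k≥ → lower {seq y N ℚ.- seq x N} {½ ℚ.* ε} (seq x k) (seq y k) (close N k ℕ.≤-refl k≥)))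

  go : ∃[ N ] Close N → ∃[ M ] (∀ k → M ℕ.≤ k → seq y k ℚ.≤ seq x k ℚ.+ ε)
  go (N , close) = split N close (_ ℚ.≤? _)

-- The terms of a nonnegative real may be slightly negative. If one factor p lies in [0, B] and the
-- other is at least -ε/B, the product is at least -ε; if both are nonpositive, the product is
-- nonnegative. Hence the tolerance for each factor is ε divided by a bound of the other.
*-nonNeg : ∀ {x y} → 0ℝ ≤ x → 0ℝ ≤ y → 0ℝ ≤ x * y
*-nonNeg {x} {y} x≥0 y≥0 ε ε>0 = go (bounded x) (bounded y)
  where
  one-sided : ∀ {B} p q → 0ℚ ℚ.< B → 0ℚ ℚ.≤ p → p ℚ.≤ B → 0ℚ ℚ.≤ q ℚ.+ inv B ℚ.* ε →
              0ℚ ℚ.≤ p ℚ.* q ℚ.+ ε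
  one-sided {B} p q B>0 p≥0 p≤B q≥ = begin
    0ℚ                                    ≡⟨ sym (ℚ.*-zeroʳ p) ⟩
    p ℚ.* 0ℚ                              ≤⟨ ℚ.*-monoˡ-≤-nonNeg p {{ℚ.nonNegative p≥0}} q≥ ⟩
    p ℚ.* (q ℚ.+ inv B ℚ.* ε)             ≡⟨ ℚ.*-distribˡ-+ p q (inv B ℚ.* ε) ⟩
    p ℚ.* q ℚ.+ p ℚ.* (inv B ℚ.* ε)       ≤⟨ ℚ.+-monoʳ-≤ (p ℚ.* q) (ℚ.*-monoʳ-≤-nonNeg (inv B ℚ.* ε)
                                               {{ℚ.nonNegative (ℚ.<⇒≤ (*-pos (inv-pos B>0) ε>0))}} p≤B) ⟩
    p ℚ.* q ℚ.+ B ℚ.* (inv B ℚ.* ε)       ≡⟨ cong (p ℚ.* q ℚ.+_) (inv-cancel ε B>0) ⟩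
    p ℚ.* q ℚ.+ ε                         ∎
    where open ℚ.≤-Reasoning

  product≥-ε : ∀ {B D} p q → 0ℚ ℚ.< B → 0ℚ ℚ.< D → ℚ.∣ p ∣ ℚ.≤ B → ℚ.∣ q ∣ ℚ.≤ D →
               0ℚ ℚ.≤ p ℚ.+ inv D ℚ.* ε → 0ℚ ℚ.≤ q ℚ.+ inv B ℚ.* ε → 0ℚ ℚ.≤ p ℚ.* q ℚ.+ ε
  product≥-ε p q B>0 D>0 p≤B q≤D p≥ q≥ with ℚ.≤-total 0ℚ p | ℚ.≤-total 0ℚ q
  ... | inj₁ p≥0 | _        = one-sided p q B>0 p≥0 (ℚ.≤-trans (p≤∣p∣ p) p≤B) q≥
  ... | inj₂ _   | inj₁ q≥0 = subst (λ r → 0ℚ ℚ.≤ r ℚ.+ ε) (ℚ.*-comm q p)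
                                (one-sided q p D>0 q≥0 (ℚ.≤-trans (p≤∣p∣ q) q≤D) p≥)
  ... | inj₂ p≤0 | inj₂ q≤0 = ℚ.+-mono-≤ {0ℚ} {p ℚ.* q} {0ℚ} {ε}
    (subst (ℚ._≤ p ℚ.* q) (ℚ.*-zeroʳ p) (ℚ.*-monoˡ-≤-nonPos p {{ℚ.nonPositive p≤0}} q≤0))
    (ℚ.<⇒≤ ε>0)

  go : Bounded x → Bounded y → ∃[ N ] (∀ k → N ℕ.≤ k → 0ℚ ℚ.≤ seq x k ℚ.* seq y k ℚ.+ ε)
  go (B , B>0 , K , b) (D , D>0 , L , d) =
    let M , f = x≥0 (inv D ℚ.* ε) (*-pos (inv-pos D>0) ε>0)
        N , g = y≥0 (inv B ℚ.* ε) (*-pos (inv-pos B>0) ε>0)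
    in (K ℕ.⊔ L) ℕ.⊔ (M ℕ.⊔ N) , λ k k≥ →
      let KL = ℕ.m⊔n≤o⇒m≤o (K ℕ.⊔ L) (M ℕ.⊔ N) k≥
          MN = ℕ.m⊔n≤o⇒n≤o (K ℕ.⊔ L) (M ℕ.⊔ N) k≥
      in product≥-ε (seq x k) (seq y k) B>0 D>0
           (b k (ℕ.m⊔n≤o⇒m≤o K L KL)) (d k (ℕ.m⊔n≤o⇒n≤o K L KL))
           (f k (ℕ.m⊔n≤o⇒m≤o M N MN)) (g k (ℕ.m⊔n≤o⇒n≤o M N MN))

recip-nonNeg : ∀ {x} (x>0 : 0ℝ < x) → 0ℝ ≤ recip x x>0
recip-nonNeg {x} (δ , δ>0 , N , δ≤) ε ε>0 = N , λ k k≥ →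
  ℚ.+-mono-≤ {0ℚ} {inv (seq x k)} {0ℚ} {ε}
    (ℚ.<⇒≤ (inv-pos (ℚ.<-≤-trans δ>0 (subst (ℚ._≤ seq x k) (ℚ.+-identityˡ δ) (δ≤ k k≥)))))
    (ℚ.<⇒≤ ε>0)

-- Early terms of x may vanish, where `inv` returns 0; the identity starts at the index from which x
-- stays above δ.
recip-inverse : ∀ {x} (x>0 : 0ℝ < x) →
                ∃[ N ] (∀ k → N ℕ.≤ k → seq x k ℚ.* seq (recip x x>0) k ≡ 1ℚ)
recip-inverse {x} (δ , δ>0 , N , δ≤) = N , λ k k≥ →
  inv-inverse (ℚ.<-≤-trans δ>0 (subst (ℚ._≤ seq x k) (ℚ.+-identityˡ δ) (δ≤ k k≥)))

x≤y⇒0≤y-x : ∀ {x y} → x ≤ y → 0ℝ ≤ y - x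
x≤y⇒0≤y-x {x} {y} = ≤-shift {0ℝ} {y - x} {x} {y} 0 λ k _ →
  ℚ.≤-reflexive (solve 2 (λ x y → con 0ℚ :- (y :- x) := x :- y) refl (seq x k) (seq y k))
  where open +-*-Solver

-- Integers do not separate the coordinates of a point of 𝒰

-- The component (0,1] of T is relaxed to [0,1], so that all of them have this form.
OddUnit : ℕ → ℝ → Set
OddUnit k x = ¬ 2 ∣ k × fromℕ k - 1ℝ ≤ x × x ≤ fromℕ k

T⇒OddUnit : ∀ {x} → T x → ∃[ k ] OddUnit k x
T⇒OddUnit {x} (inj₁ (0<x , x≤1)) =
  -- The lower endpoint `fromℕ 1 - 1ℝ` has the terms of `0ℝ` by computation.
  1 , (λ { (divides zero ()) ; (divides (suc _) ()) }) , <⇒≤ {0ℝ} {x} 0<x , x≤1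
T⇒OddUnit (inj₂ (k , _ , odd , k-1≤x , x≤k)) = k , odd , k-1≤x , x≤k

2∣n⊎2∣1+n : ∀ n → (2 ∣ n) ⊎ (2 ∣ suc n)
2∣n⊎2∣1+n zero = inj₁ (divides 0 refl)
2∣n⊎2∣1+n (suc n) with 2∣n⊎2∣1+n n
... | inj₁ (divides q refl) = inj₂ (divides (suc q) refl)
... | inj₂ 2∣1+n            = inj₁ 2∣1+n

-- A positive form of "n is not strictly between x and y", from which the sign of (n - x)(n - y) can
-- be read off in each case.
SameSide : ℕ → ℝ → ℝ → Set
SameSide n x y = (fromℕ n ≤ x × fromℕ n ≤ y) ⊎ (x ≤ fromℕ n × y ≤ fromℕ n)

OddUnit-above : ∀ {k n x} → OddUnit k x → n ℕ.< k → fromℕ n ≤ x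
OddUnit-above {k} {n} {x} (_ , k-1≤x , _) n<k = ≤-shift {fromℕ n} {x} {fromℕ k - 1ℝ} {x} 0
  (λ i _ → ℚ.+-monoˡ-≤ (ℚ.- seq x i) (begin
    ι n                          ≡⟨ solve 1 (λ n → n := con 1ℚ :+ n :- con 1ℚ) refl (ι n) ⟩
    1ℚ ℚ.+ ι n ℚ.- 1ℚ            ≡⟨ cong (ℚ._- 1ℚ) (sym (ι-+ 1 n)) ⟩
    ι (suc n) ℚ.- 1ℚ             ≤⟨ ℚ.+-monoˡ-≤ (ℚ.- 1ℚ) (ι-mono n<k) ⟩
    ι k ℚ.- 1ℚ                   ∎)) k-1≤x
  where
  open ℚ.≤-Reasoning
  open +-*-Solver

OddUnit-below : ∀ {k n x} → OddUnit k x → k ℕ.≤ n → x ≤ fromℕ n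
OddUnit-below {k} {n} {x} (_ , _ , x≤k) k≤n = ≤-shift {x} {fromℕ n} {x} {fromℕ k} 0
  (λ i _ → ℚ.+-monoʳ-≤ (seq x i) (ℚ.neg-antimono-≤ (ι-mono k≤n))) x≤k

-- The interval of y ends at j ≤ n and that of x starts at k - 1 ≥ n. If k ≥ n + 2, then x ≥ n + 1
-- and closeness gives y ≥ n. If k = n + 1 and j < n, then y ≤ n - 1 and closeness gives x ≤ n. The
-- remaining case j = n, k = n + 1 would make two consecutive integers odd.
straddle : ∀ {j k n x y} → OddUnit k x → OddUnit j y → ∣ x - y ∣ ≤ 1ℝ →
           j ℕ.≤ n → n ℕ.< k → SameSide n x y
straddle {j} {k} {n} {x} {y} X@(oddk , k-1≤x , _) Y@(oddj , _ , y≤j) x-y≤1 j≤n n<k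
  with ℕ.m≤n⇒m<n∨m≡n n<k
... | inj₁ 2+n≤k = inj₁ (OddUnit-above {x = x} X n<k ,
  -- The sum of k - 1 ≤ x and |x - y| ≤ 1; x cancels because |x - y| ≥ x - y.
  ≤-shift {fromℕ n} {y} {(fromℕ k - 1ℝ) + ∣ x - y ∣} {x + 1ℝ} 0 (λ i _ → begin
    ι n ℚ.- seq y i
      ≡⟨ solve 3 (λ n x y → n :- y := (con (ι 2) :+ n :- con 1ℚ :+ (x :- y)) :- (x :+ con 1ℚ)) refl
           (ι n) (seq x i) (seq y i) ⟩
    ι 2 ℚ.+ ι n ℚ.- 1ℚ ℚ.+ (seq x i ℚ.- seq y i) ℚ.- (seq x i ℚ.+ 1ℚ)
      ≤⟨ ℚ.+-monoˡ-≤ (ℚ.- (seq x i ℚ.+ 1ℚ)) (ℚ.+-mono-≤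
           (ℚ.+-monoˡ-≤ (ℚ.- 1ℚ) (ℚ.≤-trans (ℚ.≤-reflexive (sym (ι-+ 2 n))) (ι-mono 2+n≤k)))
           (p≤∣p∣ (seq x i ℚ.- seq y i))) ⟩
    ι k ℚ.- 1ℚ ℚ.+ ℚ.∣ seq x i ℚ.- seq y i ∣ ℚ.- (seq x i ℚ.+ 1ℚ) ∎)
    (+-mono-≤ {fromℕ k - 1ℝ} {x} {∣ x - y ∣} {1ℝ} k-1≤x x-y≤1))
  where
  open ℚ.≤-Reasoning
  open +-*-Solver
... | inj₂ refl with ℕ.m≤n⇒m<n∨m≡n j≤n
... | inj₁ 1+j≤n = inj₂ (
  ≤-shift {x} {fromℕ n} {∣ x - y ∣ + y} {1ℝ + fromℕ j} 0 (λ i _ → begin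
    seq x i ℚ.- ι n
      ≡⟨ cong (ℚ._- ι n) (solve 2 (λ x y → x := x :- y :+ y) refl (seq x i) (seq y i)) ⟩
    seq x i ℚ.- seq y i ℚ.+ seq y i ℚ.- ι n
      ≤⟨ ℚ.+-mono-≤ (ℚ.+-monoˡ-≤ (seq y i) (p≤∣p∣ (seq x i ℚ.- seq y i)))
           (ℚ.neg-antimono-≤ (ℚ.≤-trans (ℚ.≤-reflexive (sym (ι-+ 1 j))) (ι-mono 1+j≤n))) ⟩
    ℚ.∣ seq x i ℚ.- seq y i ∣ ℚ.+ seq y i ℚ.- (1ℚ ℚ.+ ι j) ∎)
    (+-mono-≤ {∣ x - y ∣} {1ℝ} {y} {fromℕ j} x-y≤1 y≤j)
  , OddUnit-below {x = y} Y j≤n)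
  where
  open ℚ.≤-Reasoning
  open +-*-Solver
... | inj₂ refl = ⊥-elim (Sum.[ oddj , oddk ] (2∣n⊎2∣1+n n))

-- Instead of comparing n with the reals x and y, one compares it with the right endpoints of their
-- unit intervals, which is decidable. Closeness of x and y enters only when the two comparisons
-- disagree.
𝒰⇒SameSide : ∀ {x y} → 𝒰 x y → ∀ n → SameSide n x y
𝒰⇒SameSide {x} {y} (Tx , Ty , x-y≤1) n with T⇒OddUnit {x} Tx | T⇒OddUnit {y} Ty
... | k , X | j , Y with n ℕ.<? k | n ℕ.<? j
... | yes n<k | yes n<j = inj₁ (OddUnit-above {x = x} X n<k , OddUnit-above {x = y} Y n<j)
... | no  n≮k | no  n≮j = inj₂ (OddUnit-below {x = x} X (ℕ.≮⇒≥ n≮k) , OddUnit-below {x = y} Y (ℕ.≮⇒≥ n≮j))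
... | yes n<k | no  n≮j = straddle {x = x} {y} X Y x-y≤1 (ℕ.≮⇒≥ n≮j) n<k
... | no  n≮k | yes n<j = Sum.map swap swap (straddle {x = y} {x} Y X y-x≤1 (ℕ.≮⇒≥ n≮k) n<j)
  where
  y-x≤1 : ∣ y - x ∣ ≤ 1ℝ
  y-x≤1 = ≤-shift {∣ y - x ∣} {1ℝ} {∣ x - y ∣} {1ℝ} 0
    (λ i _ → ℚ.≤-reflexive (cong (ℚ._- 1ℚ) (∣-∣-sym (seq y i) (seq x i)))) x-y≤1

SameSide⇒nonNeg : ∀ {n x y} → SameSide n x y → 0ℝ ≤ (fromℕ n - x) * (fromℕ n - y)
SameSide⇒nonNeg {n} {x} {y} (inj₂ (x≤n , y≤n)) =
  *-nonNeg {fromℕ n - x} {fromℕ n - y}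
    (x≤y⇒0≤y-x {x} {fromℕ n} x≤n) (x≤y⇒0≤y-x {y} {fromℕ n} y≤n)
SameSide⇒nonNeg {n} {x} {y} (inj₁ (n≤x , n≤y)) =
  ≤-shift {0ℝ} {(fromℕ n - x) * (fromℕ n - y)} {0ℝ} {(x - fromℕ n) * (y - fromℕ n)} 0
    (λ i _ → ℚ.≤-reflexive (solve 3 (λ n x y → con 0ℚ :- (n :- x) :* (n :- y) :=
      con 0ℚ :- (x :- n) :* (y :- n)) refl (ι n) (seq x i) (seq y i)))
    (*-nonNeg {x - fromℕ n} {y - fromℕ n}
      (x≤y⇒0≤y-x {fromℕ n} {x} n≤x) (x≤y⇒0≤y-x {fromℕ n} {y} n≤y))
  where open +-*-Solver


-- The weight Π (1 - n / mᵢ) in the binomial basis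

-- Both sides count pairs of a k-subset and an element of an n-set. An element outside the subset
-- extends it to a (k+1)-subset with one of its k + 1 elements marked; an element inside can be
-- chosen in k ways. The proof is by induction with Pascal's rule. The identity is multiplication by
-- n in the binomial basis.
n*nCk : ∀ n k → n ℕ.* (n C k) ≡ suc k ℕ.* (n C suc k) ℕ.+ k ℕ.* (n C k)
n*nCk zero    zero    = refl
n*nCk zero    (suc k) = sym (cong₂ ℕ._+_ (ℕ.*-zeroʳ (2 ℕ.+ k)) (ℕ.*-zeroʳ (suc k)))
n*nCk (suc n) zero    = trans (ℕ.*-identityʳ (suc n)) (sym (trans (ℕ.+-identityʳ _)
  (trans (ℕ.*-identityˡ _) (nC1≡n (suc n)))))
n*nCk (suc n) (suc k) = begin
  suc n ℕ.* (suc n C suc k)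
    ≡⟨ cong (suc n ℕ.*_) (sym (nCk+nC[k+1]≡[n+1]C[k+1] n k)) ⟩
  suc n ℕ.* (a ℕ.+ b)
    ≡⟨ solve 3 (λ n a b → (con 1 :+ n) :* (a :+ b) := n :* a :+ n :* b :+ (a :+ b)) refl n a b ⟩
  n ℕ.* a ℕ.+ n ℕ.* b ℕ.+ (a ℕ.+ b)
    ≡⟨ cong₂ (λ x y → x ℕ.+ y ℕ.+ (a ℕ.+ b)) (n*nCk n k) (n*nCk n (suc k)) ⟩
  (suc k ℕ.* b ℕ.+ k ℕ.* a) ℕ.+ (suc (suc k) ℕ.* d ℕ.+ suc k ℕ.* b) ℕ.+ (a ℕ.+ b)
    ≡⟨ solve 4 (λ k a b d →
         ((con 1 :+ k) :* b :+ k :* a) :+ ((con 2 :+ k) :* d :+ (con 1 :+ k) :* b) :+ (a :+ b) :=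
         (con 2 :+ k) :* (b :+ d) :+ (con 1 :+ k) :* (a :+ b)) refl k a b d ⟩
  suc (suc k) ℕ.* (b ℕ.+ d) ℕ.+ suc k ℕ.* (a ℕ.+ b)
    ≡⟨ cong₂ (λ x y → suc (suc k) ℕ.* x ℕ.+ suc k ℕ.* y)
         (nCk+nC[k+1]≡[n+1]C[k+1] n (suc k)) (nCk+nC[k+1]≡[n+1]C[k+1] n k) ⟩
  suc (suc k) ℕ.* (suc n C suc (suc k)) ℕ.+ suc k ℕ.* (suc n C suc k) ∎
  where
  open ≡-Reasoning
  open ℕ.+-*-Solver
  a = n C k
  b = n C suc k
  d = n C suc (suc k)

ιn*ιnCk : ∀ n k → ι n ℚ.* ι (n C k) ≡ ι (suc k) ℚ.* ι (n C suc k) ℚ.+ ι k ℚ.* ι (n C k)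
ιn*ιnCk n k = trans (sym (ι-* n (n C k))) (trans (cong ι (n*nCk n k))
  (trans (ι-+ (suc k ℕ.* (n C suc k)) (k ℕ.* (n C k)))
    (cong₂ ℚ._+_ (ι-* (suc k) (n C suc k)) (ι-* k (n C k)))))

-- Built from the same `choose` and folds as `N^`, so that for a list of explicit length the k-th
-- term of `N^ r` reduces to `elementary r` of the k-th terms.
elementary : ℕ → List ℚ → ℚ
elementary r ms = foldr ℚ._+_ 0ℚ (map (foldr ℚ._*_ 1ℚ) (choose r ms))

vieta : ∀ m₀ m₁ m₂ m₃ m₄ n → let e = λ r → elementary r (m₀ ∷ m₁ ∷ m₂ ∷ m₃ ∷ m₄ ∷ []) in
  (n ℚ.- m₀) ℚ.* ((n ℚ.- m₁) ℚ.* (n ℚ.- m₂)) ℚ.* ((n ℚ.- m₃) ℚ.* (n ℚ.- m₄)) ≡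
  n ℚ.* (n ℚ.* (n ℚ.* (n ℚ.* n))) ℚ.- e 1 ℚ.* (n ℚ.* (n ℚ.* (n ℚ.* n)))
    ℚ.+ e 2 ℚ.* (n ℚ.* (n ℚ.* n)) ℚ.- e 3 ℚ.* (n ℚ.* n) ℚ.+ e 4 ℚ.* n
    ℚ.- m₀ ℚ.* m₁ ℚ.* m₂ ℚ.* m₃ ℚ.* m₄
vieta = solve 6 (λ m₀ m₁ m₂ m₃ m₄ n →
    -- The same folds over solver polynomials, so that their evaluation reduces to `elementary`.
    let e = λ r → foldr _:+_ (con 0ℚ) (map (foldr _:*_ (con 1ℚ))
                    (choose r (m₀ ∷ m₁ ∷ m₂ ∷ m₃ ∷ m₄ ∷ [])))
    in
    (n :- m₀) :* ((n :- m₁) :* (n :- m₂)) :* ((n :- m₃) :* (n :- m₄)) :=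
    n :* (n :* (n :* (n :* n))) :- e 1 :* (n :* (n :* (n :* n))) :+ e 2 :* (n :* (n :* n))
      :- e 3 :* (n :* n) :+ e 4 :* n :- m₀ :* m₁ :* m₂ :* m₃ :* m₄)
  refl
  where open +-*-Solver

-- The cⱼ stand for the binomials n C j, and the hypotheses for `n*nCk` with k = 1, ..., 4, where n
-- C 1 is written n. As variables they are accessible to the ring solver.
module _ {n c₂ c₃ c₄ c₅ : ℚ}
  (n*n  : n ℚ.* n  ≡ ι 2 ℚ.* c₂ ℚ.+ n)
  (n*c₂ : n ℚ.* c₂ ≡ ι 3 ℚ.* c₃ ℚ.+ ι 2 ℚ.* c₂)
  (n*c₃ : n ℚ.* c₃ ≡ ι 4 ℚ.* c₄ ℚ.+ ι 3 ℚ.* c₃)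
  (n*c₄ : n ℚ.* c₄ ≡ ι 5 ℚ.* c₅ ℚ.+ ι 4 ℚ.* c₄)
  where

  open ≡-Reasoning
  open +-*-Solver

  -- In this and the next two expansions the coefficient of cⱼ in the r-th power of n is j! times a
  -- Stirling number of the second kind, the number of surjections from an r-set onto a j-set.
  cube : n ℚ.* (n ℚ.* n) ≡ ι 6 ℚ.* c₃ ℚ.+ ι 6 ℚ.* c₂ ℚ.+ n
  cube = begin
    n ℚ.* (n ℚ.* n)                      ≡⟨ cong (n ℚ.*_) n*n ⟩
    n ℚ.* (ι 2 ℚ.* c₂ ℚ.+ n)             ≡⟨ solve 2 (λ n c₂ → n :* (con (ι 2) :* c₂ :+ n) :=
                                              con (ι 2) :* (n :* c₂) :+ n :* n) refl n c₂ ⟩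
    ι 2 ℚ.* (n ℚ.* c₂) ℚ.+ n ℚ.* n       ≡⟨ cong₂ (λ x y → ι 2 ℚ.* x ℚ.+ y) n*c₂ n*n ⟩
    ι 2 ℚ.* (ι 3 ℚ.* c₃ ℚ.+ ι 2 ℚ.* c₂) ℚ.+ (ι 2 ℚ.* c₂ ℚ.+ n)
      ≡⟨ solve 3 (λ n c₂ c₃ →
           con (ι 2) :* (con (ι 3) :* c₃ :+ con (ι 2) :* c₂) :+ (con (ι 2) :* c₂ :+ n) :=
           con (ι 6) :* c₃ :+ con (ι 6) :* c₂ :+ n) refl n c₂ c₃ ⟩
    ι 6 ℚ.* c₃ ℚ.+ ι 6 ℚ.* c₂ ℚ.+ n      ∎

  fourth : n ℚ.* (n ℚ.* (n ℚ.* n)) ≡ ι 24 ℚ.* c₄ ℚ.+ ι 36 ℚ.* c₃ ℚ.+ ι 14 ℚ.* c₂ ℚ.+ n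
  fourth = begin
    n ℚ.* (n ℚ.* (n ℚ.* n))                              ≡⟨ cong (n ℚ.*_) cube ⟩
    n ℚ.* (ι 6 ℚ.* c₃ ℚ.+ ι 6 ℚ.* c₂ ℚ.+ n)
      ≡⟨ solve 3 (λ n c₂ c₃ → n :* (con (ι 6) :* c₃ :+ con (ι 6) :* c₂ :+ n) :=
           con (ι 6) :* (n :* c₃) :+ con (ι 6) :* (n :* c₂) :+ n :* n) refl n c₂ c₃ ⟩
    ι 6 ℚ.* (n ℚ.* c₃) ℚ.+ ι 6 ℚ.* (n ℚ.* c₂) ℚ.+ n ℚ.* n
      ≡⟨ cong₂ ℚ._+_ (cong₂ (λ x y → ι 6 ℚ.* x ℚ.+ ι 6 ℚ.* y) n*c₃ n*c₂) n*n ⟩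
    ι 6 ℚ.* (ι 4 ℚ.* c₄ ℚ.+ ι 3 ℚ.* c₃) ℚ.+ ι 6 ℚ.* (ι 3 ℚ.* c₃ ℚ.+ ι 2 ℚ.* c₂) ℚ.+ (ι 2 ℚ.* c₂ ℚ.+ n)
      ≡⟨ solve 4 (λ n c₂ c₃ c₄ →
           con (ι 6) :* (con (ι 4) :* c₄ :+ con (ι 3) :* c₃)
             :+ con (ι 6) :* (con (ι 3) :* c₃ :+ con (ι 2) :* c₂) :+ (con (ι 2) :* c₂ :+ n) :=
           con (ι 24) :* c₄ :+ con (ι 36) :* c₃ :+ con (ι 14) :* c₂ :+ n) refl n c₂ c₃ c₄ ⟩
    ι 24 ℚ.* c₄ ℚ.+ ι 36 ℚ.* c₃ ℚ.+ ι 14 ℚ.* c₂ ℚ.+ n    ∎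

  fifth : n ℚ.* (n ℚ.* (n ℚ.* (n ℚ.* n))) ≡
          ι 120 ℚ.* c₅ ℚ.+ ι 240 ℚ.* c₄ ℚ.+ ι 150 ℚ.* c₃ ℚ.+ ι 30 ℚ.* c₂ ℚ.+ n
  fifth = begin
    n ℚ.* (n ℚ.* (n ℚ.* (n ℚ.* n)))                      ≡⟨ cong (n ℚ.*_) fourth ⟩
    n ℚ.* (ι 24 ℚ.* c₄ ℚ.+ ι 36 ℚ.* c₃ ℚ.+ ι 14 ℚ.* c₂ ℚ.+ n)
      ≡⟨ solve 4 (λ n c₂ c₃ c₄ →
           n :* (con (ι 24) :* c₄ :+ con (ι 36) :* c₃ :+ con (ι 14) :* c₂ :+ n) :=
           con (ι 24) :* (n :* c₄) :+ con (ι 36) :* (n :* c₃) :+ con (ι 14) :* (n :* c₂) :+ n :* n)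
           refl n c₂ c₃ c₄ ⟩
    ι 24 ℚ.* (n ℚ.* c₄) ℚ.+ ι 36 ℚ.* (n ℚ.* c₃) ℚ.+ ι 14 ℚ.* (n ℚ.* c₂) ℚ.+ n ℚ.* n
      ≡⟨ cong₂ ℚ._+_ (cong₂ ℚ._+_ (cong₂ (λ x y → ι 24 ℚ.* x ℚ.+ ι 36 ℚ.* y) n*c₄ n*c₃)
           (cong (ι 14 ℚ.*_) n*c₂)) n*n ⟩
    ι 24 ℚ.* (ι 5 ℚ.* c₅ ℚ.+ ι 4 ℚ.* c₄) ℚ.+ ι 36 ℚ.* (ι 4 ℚ.* c₄ ℚ.+ ι 3 ℚ.* c₃)
      ℚ.+ ι 14 ℚ.* (ι 3 ℚ.* c₃ ℚ.+ ι 2 ℚ.* c₂) ℚ.+ (ι 2 ℚ.* c₂ ℚ.+ n)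
      ≡⟨ solve 5 (λ n c₂ c₃ c₄ c₅ →
           con (ι 24) :* (con (ι 5) :* c₅ :+ con (ι 4) :* c₄)
             :+ con (ι 36) :* (con (ι 4) :* c₄ :+ con (ι 3) :* c₃)
             :+ con (ι 14) :* (con (ι 3) :* c₃ :+ con (ι 2) :* c₂) :+ (con (ι 2) :* c₂ :+ n) :=
           con (ι 120) :* c₅ :+ con (ι 240) :* c₄ :+ con (ι 150) :* c₃ :+ con (ι 30) :* c₂ :+ n)
           refl n c₂ c₃ c₄ c₅ ⟩
    ι 120 ℚ.* c₅ ℚ.+ ι 240 ℚ.* c₄ ℚ.+ ι 150 ℚ.* c₃ ℚ.+ ι 30 ℚ.* c₂ ℚ.+ n ∎

  -- Expanding the powers on the right by `fifth`, `fourth`, `cube` and `n*n` and collecting each cⱼ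
  -- yields the coefficients of the theorem: for c₂, for instance, -(30 - 14e₁ + 6e₂ - 2e₃) = 2(e₃ -
  -- 3e₂ + 7e₁ - 15).
  binomial-weight : ∀ {e₁ e₂ e₃ e₄ Q q} → Q ℚ.* q ≡ 1ℚ →
    1ℚ ℚ.- ((e₄ ℚ.- e₃ ℚ.+ e₂ ℚ.- e₁ ℚ.+ ι 1) ℚ.* q) ℚ.* n
      ℚ.+ ((ι 2 ℚ.* (e₃ ℚ.- ι 3 ℚ.* e₂ ℚ.+ ι 7 ℚ.* e₁ ℚ.- ι 15)) ℚ.* q) ℚ.* c₂
      ℚ.- ((ι 6 ℚ.* (e₂ ℚ.- ι 6 ℚ.* e₁ ℚ.+ ι 25)) ℚ.* q) ℚ.* c₃
      ℚ.+ ((ι 24 ℚ.* (e₁ ℚ.- ι 10)) ℚ.* q) ℚ.* c₄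
      ℚ.- (ι 120 ℚ.* q) ℚ.* c₅
    ≡ ℚ.- ((n ℚ.* (n ℚ.* (n ℚ.* (n ℚ.* n))) ℚ.- e₁ ℚ.* (n ℚ.* (n ℚ.* (n ℚ.* n)))
        ℚ.+ e₂ ℚ.* (n ℚ.* (n ℚ.* n)) ℚ.- e₃ ℚ.* (n ℚ.* n) ℚ.+ e₄ ℚ.* n ℚ.- Q) ℚ.* q)
  binomial-weight {e₁} {e₂} {e₃} {e₄} {Q} {q} Qq≡1 = begin
    weight 1ℚ
      -- With the leading 1 written as Q q, what remains is a polynomial identity.
      ≡⟨ cong weight (sym Qq≡1) ⟩
    weight (Q ℚ.* q)
      ≡⟨ solve 11 (λ n c₂ c₃ c₄ c₅ e₁ e₂ e₃ e₄ Q q →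
           Q :* q :- ((e₄ :- e₃ :+ e₂ :- e₁ :+ con (ι 1)) :* q) :* n
             :+ ((con (ι 2) :* (e₃ :- con (ι 3) :* e₂ :+ con (ι 7) :* e₁ :- con (ι 15))) :* q) :* c₂
             :- ((con (ι 6) :* (e₂ :- con (ι 6) :* e₁ :+ con (ι 25))) :* q) :* c₃
             :+ ((con (ι 24) :* (e₁ :- con (ι 10))) :* q) :* c₄
             :- (con (ι 120) :* q) :* c₅ :=
           :- (((con (ι 120) :* c₅ :+ con (ι 240) :* c₄ :+ con (ι 150) :* c₃ :+ con (ι 30) :* c₂ :+ n)
             :- e₁ :* (con (ι 24) :* c₄ :+ con (ι 36) :* c₃ :+ con (ι 14) :* c₂ :+ n)
             :+ e₂ :* (con (ι 6) :* c₃ :+ con (ι 6) :* c₂ :+ n)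
             :- e₃ :* (con (ι 2) :* c₂ :+ n) :+ e₄ :* n :- Q) :* q))
           refl n c₂ c₃ c₄ c₅ e₁ e₂ e₃ e₄ Q q ⟩
    ℚ.- (((ι 120 ℚ.* c₅ ℚ.+ ι 240 ℚ.* c₄ ℚ.+ ι 150 ℚ.* c₃ ℚ.+ ι 30 ℚ.* c₂ ℚ.+ n)
      ℚ.- e₁ ℚ.* (ι 24 ℚ.* c₄ ℚ.+ ι 36 ℚ.* c₃ ℚ.+ ι 14 ℚ.* c₂ ℚ.+ n)
      ℚ.+ e₂ ℚ.* (ι 6 ℚ.* c₃ ℚ.+ ι 6 ℚ.* c₂ ℚ.+ n)
      ℚ.- e₃ ℚ.* (ι 2 ℚ.* c₂ ℚ.+ n) ℚ.+ e₄ ℚ.* n ℚ.- Q) ℚ.* q)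
      ≡⟨ sym (cong (λ x → ℚ.- ((x ℚ.+ e₄ ℚ.* n ℚ.- Q) ℚ.* q))
           (cong₂ (λ x y → x ℚ.- e₃ ℚ.* y)
             (cong₂ (λ x y → x ℚ.+ e₂ ℚ.* y) (cong₂ (λ x y → x ℚ.- e₁ ℚ.* y) fifth fourth) cube)
             n*n)) ⟩
    ℚ.- ((n ℚ.* (n ℚ.* (n ℚ.* (n ℚ.* n))) ℚ.- e₁ ℚ.* (n ℚ.* (n ℚ.* (n ℚ.* n)))
      ℚ.+ e₂ ℚ.* (n ℚ.* (n ℚ.* n)) ℚ.- e₃ ℚ.* (n ℚ.* n) ℚ.+ e₄ ℚ.* n ℚ.- Q) ℚ.* q) ∎
    where
    weight : ℚ → ℚ
    weight u = u ℚ.- ((e₄ ℚ.- e₃ ℚ.+ e₂ ℚ.- e₁ ℚ.+ ι 1) ℚ.* q) ℚ.* n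
      ℚ.+ ((ι 2 ℚ.* (e₃ ℚ.- ι 3 ℚ.* e₂ ℚ.+ ι 7 ℚ.* e₁ ℚ.- ι 15)) ℚ.* q) ℚ.* c₂
      ℚ.- ((ι 6 ℚ.* (e₂ ℚ.- ι 6 ℚ.* e₁ ℚ.+ ι 25)) ℚ.* q) ℚ.* c₃
      ℚ.+ ((ι 24 ℚ.* (e₁ ℚ.- ι 10)) ℚ.* q) ℚ.* c₄
      ℚ.- (ι 120 ℚ.* q) ℚ.* c₅

-- The lower bound as a linear functional of the six counts

module Functional (a₁ a₂ a₃ a₄ a₅ : ℝ) where

  -- Properties of `L` are stated as upper bounds `L f ≤ x`: equality of reals is a setoid relation,
  -- and only upper bounds have to be carried to the end.
  L : (ℕ → ℕ) → ℝ
  L f = fromℕ (f 0) - a₁ * fromℕ (f 1) + a₂ * fromℕ (f 2) - a₃ * fromℕ (f 3)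
          + a₄ * fromℕ (f 4) - a₅ * fromℕ (f 5)

  L-cong : ∀ {f g x} → (∀ r → f r ≡ g r) → L g ≤ x → L f ≤ x
  L-cong {f} {g} {x} f≗g = ≤-shift {L f} {x} {L g} {x} 0 λ k _ → ℚ.≤-reflexive
    (cong (ℚ._- seq x k) (pointwise (f≗g 0) (f≗g 1) (f≗g 2) (f≗g 3) (f≗g 4) (f≗g 5)))
    where
    pointwise : ∀ {u₀ u₁ u₂ u₃ u₄ u₅ v₀ v₁ v₂ v₃ v₄ v₅ k} → u₀ ≡ v₀ → u₁ ≡ v₁ → u₂ ≡ v₂ →
      u₃ ≡ v₃ → u₄ ≡ v₄ → u₅ ≡ v₅ →
      ι u₀ ℚ.- seq a₁ k ℚ.* ι u₁ ℚ.+ seq a₂ k ℚ.* ι u₂ ℚ.- seq a₃ k ℚ.* ι u₃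
        ℚ.+ seq a₄ k ℚ.* ι u₄ ℚ.- seq a₅ k ℚ.* ι u₅ ≡
      ι v₀ ℚ.- seq a₁ k ℚ.* ι v₁ ℚ.+ seq a₂ k ℚ.* ι v₂ ℚ.- seq a₃ k ℚ.* ι v₃
        ℚ.+ seq a₄ k ℚ.* ι v₄ ℚ.- seq a₅ k ℚ.* ι v₅
    pointwise refl refl refl refl refl refl = refl

  -- For n = 1 this is the row 0 C r of binomials, for n = 0 the row of empty sums.
  only : ℕ → ℕ → ℕ
  only n zero    = n
  only n (suc _) = 0

  L-only : ∀ n → L (only n) ≤ fromℕ n
  L-only n = ≤-shift {L (only n)} {fromℕ n} {0ℝ} {0ℝ} 0 (λ k _ → ℚ.≤-reflexive
    (solve 6 (λ n a₁ a₂ a₃ a₄ a₅ → n :- a₁ :* con 0ℚ :+ a₂ :* con 0ℚ :- a₃ :* con 0ℚ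
        :+ a₄ :* con 0ℚ :- a₅ :* con 0ℚ :- n := con 0ℚ :- con 0ℚ)
      refl (ι n) (seq a₁ k) (seq a₂ k) (seq a₃ k) (seq a₄ k) (seq a₅ k))) (≤-refl {0ℝ})
    where open +-*-Solver

  L-+ : ∀ {x y} f g → L f ≤ x → L g ≤ y → L (λ r → f r ℕ.+ g r) ≤ x + y
  L-+ {x} {y} f g Lf≤x Lg≤y = ≤-shift {L (λ r → f r ℕ.+ g r)} {x + y} {L f + L g} {x + y} 0
    (λ k _ → ℚ.≤-reflexive (cong (ℚ._- (seq x k ℚ.+ seq y k))
      (pointwise (seq a₁ k) (seq a₂ k) (seq a₃ k) (seq a₄ k) (seq a₅ k)
        (ι-+ (f 0) (g 0)) (ι-+ (f 1) (g 1)) (ι-+ (f 2) (g 2))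
        (ι-+ (f 3) (g 3)) (ι-+ (f 4) (g 4)) (ι-+ (f 5) (g 5)))))
    (+-mono-≤ {L f} {x} {L g} {y} Lf≤x Lg≤y)
    where
    open +-*-Solver
    pointwise : ∀ {u₀ u₁ u₂ u₃ u₄ u₅ v₀ v₁ v₂ v₃ v₄ v₅ w₀ w₁ w₂ w₃ w₄ w₅} α₁ α₂ α₃ α₄ α₅ →
      w₀ ≡ u₀ ℚ.+ v₀ → w₁ ≡ u₁ ℚ.+ v₁ → w₂ ≡ u₂ ℚ.+ v₂ →
      w₃ ≡ u₃ ℚ.+ v₃ → w₄ ≡ u₄ ℚ.+ v₄ → w₅ ≡ u₅ ℚ.+ v₅ →
      w₀ ℚ.- α₁ ℚ.* w₁ ℚ.+ α₂ ℚ.* w₂ ℚ.- α₃ ℚ.* w₃ ℚ.+ α₄ ℚ.* w₄ ℚ.- α₅ ℚ.* w₅ ≡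
      (u₀ ℚ.- α₁ ℚ.* u₁ ℚ.+ α₂ ℚ.* u₂ ℚ.- α₃ ℚ.* u₃ ℚ.+ α₄ ℚ.* u₄ ℚ.- α₅ ℚ.* u₅)
        ℚ.+ (v₀ ℚ.- α₁ ℚ.* v₁ ℚ.+ α₂ ℚ.* v₂ ℚ.- α₃ ℚ.* v₃ ℚ.+ α₄ ℚ.* v₄ ℚ.- α₅ ℚ.* v₅)
    pointwise {u₀} {u₁} {u₂} {u₃} {u₄} {u₅} {v₀} {v₁} {v₂} {v₃} {v₄} {v₅} α₁ α₂ α₃ α₄ α₅
      refl refl refl refl refl refl =
      solve 17 (λ α₁ α₂ α₃ α₄ α₅ u₀ u₁ u₂ u₃ u₄ u₅ v₀ v₁ v₂ v₃ v₄ v₅ →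
        (u₀ :+ v₀) :- α₁ :* (u₁ :+ v₁) :+ α₂ :* (u₂ :+ v₂) :- α₃ :* (u₃ :+ v₃)
          :+ α₄ :* (u₄ :+ v₄) :- α₅ :* (u₅ :+ v₅) :=
        (u₀ :- α₁ :* u₁ :+ α₂ :* u₂ :- α₃ :* u₃ :+ α₄ :* u₄ :- α₅ :* u₅)
          :+ (v₀ :- α₁ :* v₁ :+ α₂ :* v₂ :- α₃ :* v₃ :+ α₄ :* v₄ :- α₅ :* v₅))
        refl α₁ α₂ α₃ α₄ α₅ u₀ u₁ u₂ u₃ u₄ u₅ v₀ v₁ v₂ v₃ v₄ v₅

  L-sum : ∀ {A : Set} (f : ℕ → A → ℕ) (g : A → ℕ) →
          (∀ a → L (λ r → f r a) ≤ fromℕ (g a)) →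
          ∀ as → L (λ r → sum (map (f r) as)) ≤ fromℕ (sum (map g as))
  L-sum f g Lf≤g []       = L-only 0
  L-sum f g Lf≤g (a ∷ as) =
    ≤-shift {L (λ r → sum (map (f r) (a ∷ as)))} {fromℕ (sum (map g (a ∷ as)))}
      {L (λ r → sum (map (f r) (a ∷ as)))} {fromℕ (g a) + fromℕ (sum (map g as))} 0
      (λ k _ → ℚ.≤-reflexive (cong (λ x → seq (L (λ r → sum (map (f r) (a ∷ as)))) k ℚ.- x)
        (ι-+ (g a) (sum (map g as)))))
      (L-+ {fromℕ (g a)} {fromℕ (sum (map g as))} (λ r → f r a) (λ r → sum (map (f r) as))
        (Lf≤g a) (L-sum f g Lf≤g as))

-- The sign of the weight

isZero : ℕ → ℕ
isZero zero    = 1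
isZero (suc _) = 0

module Weight {m₀ m₁ m₂ m₃ m₄ : ℝ} (m₀>0 : 0ℝ < m₀) (m₀≤1 : m₀ ≤ 1ℝ)
              (u₁₂ : 𝒰 m₁ m₂) (u₃₄ : 𝒰 m₃ m₄) where

  N₅ : ℕ → ℝ
  N₅ r = N^ r (m₀ ∷ m₁ ∷ m₂ ∷ m₃ ∷ m₄ ∷ [])

  Q : ℝ
  Q = m₀ * m₁ * m₂ * m₃ * m₄

  Q>0 : 0ℝ < Q
  Q>0 = Q-positive {m₀} {m₁} {m₂} {m₃} {m₄} m₀>0 u₁₂ u₃₄

  1/Q : ℝ
  1/Q = recip Q Q>0

  open Functional
    ((N₅ 4 - N₅ 3 + N₅ 2 - N₅ 1 + fromℕ 1) * 1/Q)
    ((fromℕ 2 * (N₅ 3 - fromℕ 3 * N₅ 2 + fromℕ 7 * N₅ 1 - fromℕ 15)) * 1/Q)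
    ((fromℕ 6 * (N₅ 2 - fromℕ 6 * N₅ 1 + fromℕ 25)) * 1/Q)
    ((fromℕ 24 * (N₅ 1 - fromℕ 10)) * 1/Q)
    (fromℕ 120 * 1/Q)
    public

  -- For n = 0 only the leading 1 survives. For n ≥ 1 the weight is -P/Q, and P is a product of
  -- three nonnegative factors: n - m₀, because m₀ ≤ 1, and one for each pair in 𝒰.
  L-binomial : ∀ n → L (λ r → n C r) ≤ fromℕ (isZero n)
  L-binomial zero      = L-only 1
  -- The weight agrees with -P/Q from the index at which Q times its reciprocal becomes 1.
  L-binomial n@(suc _) = ≤-shift {L (λ r → n C r)} {0ℝ} {0ℝ} {P * 1/Q} (proj₁ inverse)
    (λ k k≥ → ℚ.≤-reflexive (begin
      seq (L (λ r → n C r)) k ℚ.- 0ℚ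
        ≡⟨ ℚ.+-identityʳ (seq (L (λ r → n C r)) k) ⟩
      seq (L (λ r → n C r)) k
        ≡⟨ cong (λ x → 1ℚ ℚ.- A₁ k ℚ.* x ℚ.+ A₂ k ℚ.* ι (n C 2) ℚ.- A₃ k ℚ.* ι (n C 3)
             ℚ.+ A₄ k ℚ.* ι (n C 4) ℚ.- A₅ k ℚ.* ι (n C 5)) (cong ι (nC1≡n n)) ⟩
      1ℚ ℚ.- A₁ k ℚ.* ι n ℚ.+ A₂ k ℚ.* ι (n C 2) ℚ.- A₃ k ℚ.* ι (n C 3)
        ℚ.+ A₄ k ℚ.* ι (n C 4) ℚ.- A₅ k ℚ.* ι (n C 5)
        ≡⟨ binomial-weight {ι n} {ι (n C 2)} {ι (n C 3)} {ι (n C 4)} {ι (n C 5)} n*n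
             (ιn*ιnCk n 2) (ιn*ιnCk n 3) (ιn*ιnCk n 4)
             {e k 1} {e k 2} {e k 3} {e k 4} {seq Q k} {seq 1/Q k} (proj₂ inverse k k≥) ⟩
      -- The polynomial in powers of n from `binomial-weight`, which `vieta` factors.
      _
        ≡⟨ cong (λ x → ℚ.- (x ℚ.* seq 1/Q k))
             (sym (vieta (seq m₀ k) (seq m₁ k) (seq m₂ k) (seq m₃ k) (seq m₄ k) (ι n))) ⟩
      ℚ.- seq (P * 1/Q) k
        ≡⟨ sym (ℚ.+-identityˡ (ℚ.- seq (P * 1/Q) k)) ⟩
      0ℚ ℚ.- seq (P * 1/Q) k ∎))
    (*-nonNeg {P} {1/Q}
      (*-nonNeg {(fromℕ n - m₀) * P₁₂} {P₃₄}
        (*-nonNeg {fromℕ n - m₀} {P₁₂} (x≤y⇒0≤y-x {m₀} {fromℕ n} m₀≤n)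
          (SameSide⇒nonNeg {n} {m₁} {m₂} (𝒰⇒SameSide {m₁} {m₂} u₁₂ n)))
        (SameSide⇒nonNeg {n} {m₃} {m₄} (𝒰⇒SameSide {m₃} {m₄} u₃₄ n)))
      (recip-nonNeg {Q} Q>0))
    where
    open ≡-Reasoning
    P₁₂ P₃₄ P : ℝ
    P₁₂ = (fromℕ n - m₁) * (fromℕ n - m₂)
    P₃₄ = (fromℕ n - m₃) * (fromℕ n - m₄)
    P   = (fromℕ n - m₀) * P₁₂ * P₃₄

    inverse = recip-inverse {Q} Q>0

    e : ℕ → ℕ → ℚ
    e k r = elementary r (seq m₀ k ∷ seq m₁ k ∷ seq m₂ k ∷ seq m₃ k ∷ seq m₄ k ∷ [])

    A₁ A₂ A₃ A₄ A₅ : ℕ → ℚ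
    A₁ k = (e k 4 ℚ.- e k 3 ℚ.+ e k 2 ℚ.- e k 1 ℚ.+ ι 1) ℚ.* seq 1/Q k
    A₂ k = (ι 2 ℚ.* (e k 3 ℚ.- ι 3 ℚ.* e k 2 ℚ.+ ι 7 ℚ.* e k 1 ℚ.- ι 15)) ℚ.* seq 1/Q k
    A₃ k = (ι 6 ℚ.* (e k 2 ℚ.- ι 6 ℚ.* e k 1 ℚ.+ ι 25)) ℚ.* seq 1/Q k
    A₄ k = (ι 24 ℚ.* (e k 1 ℚ.- ι 10)) ℚ.* seq 1/Q k
    A₅ k = ι 120 ℚ.* seq 1/Q k

    n*n : ι n ℚ.* ι n ≡ ι 2 ℚ.* ι (n C 2) ℚ.+ ι n
    n*n = begin
      ι n ℚ.* ι n                                  ≡⟨ cong (λ m → ι n ℚ.* ι m) (sym (nC1≡n n)) ⟩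
      ι n ℚ.* ι (n C 1)                            ≡⟨ ιn*ιnCk n 1 ⟩
      ι 2 ℚ.* ι (n C 2) ℚ.+ ι 1 ℚ.* ι (n C 1)      ≡⟨ cong (ι 2 ℚ.* ι (n C 2) ℚ.+_)
                                                      (trans (ℚ.*-identityˡ (ι (n C 1))) (cong ι (nC1≡n n))) ⟩
      ι 2 ℚ.* ι (n C 2) ℚ.+ ι n                    ∎

    m₀≤n : m₀ ≤ fromℕ n
    m₀≤n = ≤-shift {m₀} {fromℕ n} {m₀} {1ℝ} 0
      (λ k _ → ℚ.+-monoʳ-≤ (seq m₀ k) (ℚ.neg-antimono-≤ (ι-mono {1} {n} (ℕ.s≤s ℕ.z≤n)))) m₀≤1

-- Counting the integers with prescribed prime divisors

Unique-resp-⊆ : ∀ {A : Set} {xs ys : List A} → xs ⊆ ys → Unique ys → Unique xs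
Unique-resp-⊆ []             []       = []
Unique-resp-⊆ (y ∷ʳ xs⊆ys)   (_ ∷ u)  = Unique-resp-⊆ xs⊆ys u
Unique-resp-⊆ (refl ∷ xs⊆ys) (y∉ ∷ u) = All-resp-⊆ xs⊆ys y∉ ∷ Unique-resp-⊆ xs⊆ys u

∈-choose⇒⊆ : ∀ {A : Set} r (xs : List A) {ys} → ys ∈ choose r xs → ys ⊆ xs
∈-choose⇒⊆ zero    xs       (here refl) = minimum xs
∈-choose⇒⊆ (suc r) (x ∷ xs) ys∈ with ∈-++⁻ (map (x ∷_) (choose r xs)) ys∈
... | inj₂ ys∈′ = x ∷ʳ ∈-choose⇒⊆ (suc r) xs ys∈′
... | inj₁ ys∈′ with ∈-map⁻ (x ∷_) ys∈′
... | _ , zs∈ , refl = refl ∷ ∈-choose⇒⊆ r xs zs∈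

length-choose : ∀ {A : Set} r (xs : List A) → length (choose r xs) ≡ length xs C r
length-choose zero    xs       = refl
length-choose (suc r) []       = refl
length-choose (suc r) (x ∷ xs) = begin
  length (map (x ∷_) (choose r xs) ++ choose (suc r) xs)
    ≡⟨ length-++ (map (x ∷_) (choose r xs)) ⟩
  length (map (x ∷_) (choose r xs)) ℕ.+ length (choose (suc r) xs)
    ≡⟨ cong₂ ℕ._+_ (trans (length-map (x ∷_) (choose r xs)) (length-choose r xs))
         (length-choose (suc r) xs) ⟩
  length xs C r ℕ.+ length xs C suc r
    ≡⟨ nCk+nC[k+1]≡[n+1]C[k+1] (length xs) r ⟩
  suc (length xs) C suc r ∎
  where open ≡-Reasoning

module _ {A : Set} {P : Pred A 0ℓ} (P? : Decidable P) where

  filter-all?-map-∷ : ∀ {x} → P x → ∀ yss →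
                      filter (all? P?) (map (x ∷_) yss) ≡ map (x ∷_) (filter (all? P?) yss)
  filter-all?-map-∷ Px []         = refl
  filter-all?-map-∷ {x} Px (ys ∷ yss) = by-cases (all? P? ys)
    where
    by-cases : Dec (All P ys) → filter (all? P?) ((x ∷ ys) ∷ map (x ∷_) yss) ≡
                                map (x ∷_) (filter (all? P?) (ys ∷ yss))
    by-cases (yes Pys) = trans (filter-accept (all? P?) (Px ∷ Pys))
      (trans (cong ((x ∷ ys) ∷_) (filter-all?-map-∷ Px yss))
        (sym (cong (map (x ∷_)) (filter-accept (all? P?) Pys))))
    by-cases (no ¬Pys) = trans (filter-reject (all? P?) (¬Pys ∘ All.tail))
      (trans (filter-all?-map-∷ Px yss) (sym (cong (map (x ∷_)) (filter-reject (all? P?) ¬Pys))))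

  filter-all?-map-∷-none : ∀ {x} → ¬ P x → ∀ yss → filter (all? P?) (map (x ∷_) yss) ≡ []
  filter-all?-map-∷-none ¬Px []         = refl
  filter-all?-map-∷-none ¬Px (ys ∷ yss) =
    trans (filter-reject (all? P?) (¬Px ∘ All.head)) (filter-all?-map-∷-none ¬Px yss)

  -- A chosen sublist that starts with x survives only if `P x` holds. With P the divisibility of b,
  -- the r-tuples of primes that all divide b become the r-sublists of its prime divisors.
  filter-choose : ∀ r xs → filter (all? P?) (choose r xs) ≡ choose r (filter P? xs)
  filter-choose zero    xs       = refl
  filter-choose (suc r) []       = refl
  filter-choose (suc r) (x ∷ xs)
    rewrite filter-++ (all? P?) (map (x ∷_) (choose r xs)) (choose (suc r) xs) with P? x
  ... | yes Px rewrite filter-all?-map-∷ Px (choose r xs) =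
    cong₂ _++_ (cong (map (x ∷_)) (filter-choose r xs)) (filter-choose (suc r) xs)
  ... | no ¬Px rewrite filter-all?-map-∷-none ¬Px (choose r xs) = filter-choose (suc r) xs

module _ {A B : Set} {R : A → B → Set} (R? : ∀ a b → Dec (R a b)) where

  private
    column : A → List B → ℕ
    column a bs = length (filter (R? a) bs)

    row : List A → B → ℕ
    row as b = length (filter (λ a → R? a b) as)

    sum-row-∷ : ∀ a as bs → sum (map (row (a ∷ as)) bs) ≡ column a bs ℕ.+ sum (map (row as) bs)
    sum-row-∷ a as []       = refl
    sum-row-∷ a as (b ∷ bs) rewrite sum-row-∷ a as bs with R? a b
    ... | yes _ = cong suc (solve 3 (λ x y z → x :+ (y :+ z) := y :+ (x :+ z)) refl
                    (row as b) (column a bs) (sum (map (row as) bs)))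
      where open ℕ.+-*-Solver
    ... | no  _ = solve 3 (λ x y z → x :+ (y :+ z) := y :+ (x :+ z)) refl
                    (row as b) (column a bs) (sum (map (row as) bs))
      where open ℕ.+-*-Solver

  -- Exchanges the sum over tuples of primes with the sum over the integers they divide.
  double-counting : ∀ as bs → sum (map (λ a → length (filter (R? a) bs)) as) ≡
                              sum (map (λ b → length (filter (λ a → R? a b) as)) bs)
  double-counting []       []       = refl
  double-counting []       (b ∷ bs) = double-counting [] bs
  double-counting (a ∷ as) bs       =
    trans (cong (column a bs ℕ.+_) (double-counting as bs)) (sym (sum-row-∷ a as bs))

sum-map-cong : ∀ {A : Set} {f g : A → ℕ} xs → (∀ {x} → x ∈ xs → f x ≡ g x) →
               sum (map f xs) ≡ sum (map g xs)
sum-map-cong []       f≗g = refl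
sum-map-cong (x ∷ xs) f≗g = cong₂ ℕ._+_ (f≗g (here refl)) (sum-map-cong xs (f≗g ∘ there))

sum-map-1 : ∀ {A : Set} (xs : List A) → sum (map (λ _ → 1) xs) ≡ length xs
sum-map-1 []       = refl
sum-map-1 (x ∷ xs) = cong suc (sum-map-1 xs)

sum-isZero : ∀ {A : Set} (f : A → ℕ) xs →
             sum (map (isZero ∘ f) xs) ≡ length (filter (λ x → f x ℕ.≟ 0) xs)
sum-isZero f []       = refl
sum-isZero f (x ∷ xs) with f x
... | zero  = cong suc (sum-isZero f xs)
... | suc _ = sum-isZero f xs

unique-length : ∀ {A : Set} {xs ys : List A} → Unique xs → Unique ys →
                (∀ {x} → x ∈ xs → x ∈ ys) → (∀ {x} → x ∈ ys → x ∈ xs) → length xs ≡ length ys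
unique-length u v to from = ↭-length (∼bag⇒↭ (unique∧set⇒bag u v (mk⇔ to from)))

Unique-÷ : ∀ 𝒜 d → Unique (𝒜 ÷ d)
Unique-÷ 𝒜 d = Unique.filter⁺ (λ a → a ℕ.* d ∈? 𝒜)
  (Unique.map⁺ ℕ.suc-injective (Unique.upTo⁺ (max 0 𝒜)))

product∣⇒All∣ : ∀ {n} ps → product ps ∣ n → All (_∣ n) ps
product∣⇒All∣ []       _   = []
product∣⇒All∣ (p ∷ ps) p∣n =
  ∣-trans (m∣m*n (product ps)) p∣n ∷ product∣⇒All∣ ps (∣-trans (n∣m*n p) p∣n)

-- By induction n is q times the product of `ps`. The prime p divides n but not that product, since
-- otherwise it would occur in `ps`; so it divides q.
All∣⇒product∣ : ∀ {n ps} → All Prime ps → Unique ps → All (_∣ n) ps → product ps ∣ n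
All∣⇒product∣ []              []         []             = 1∣ _
All∣⇒product∣ {n} {p ∷ ps} (pp ∷ primes) (p∉ ∷ u) (p∣n ∷ ps∣n)
  with All∣⇒product∣ primes u ps∣n
... | divides q refl with euclidsLemma q (product ps) pp p∣n
... | inj₁ (divides r refl) = divides r (ℕ.*-assoc r p (product ps))
... | inj₂ p∣Πps = ⊥-elim (All.lookup p∉ (factorisationHasAllPrimeFactors pp p∣Πps primes) refl)

-- The sums of the theorem through the number of prime divisors in [w, z)

module SieveIdentities (em : ExcludedMiddle 0ℓ) where

  open Sieve em

  Sifted : ℝ → ℕ → Set
  Sifted z a = ¬ (∃[ p ] (Prime p × p ∣ a × fromℕ p < z))

  -- The same decision as in `S`, so that `S 𝒜 z` unfolds to `length (filter (sifted? z) 𝒜)`.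
  sifted? : ∀ z → Decidable (Sifted z)
  sifted? z a = em {Sifted z a}

  primeDivisors : ℝ → ℝ → ℕ → List ℕ
  primeDivisors w z b = filter (_∣? b) primes[ w , z ⟩

  ω : ℝ → ℝ → ℕ → ℕ
  ω w z b = length (primeDivisors w z b)

  module _ {𝒜 : List ℕ} (unique : Unique 𝒜) (positive : All (0 ℕ.<_) 𝒜) where

    -- Multiplication by d, the product of `ps`, is the bijection. It preserves being sifted by w
    -- because every prime factor of d is one of `ps`, hence at least w; and d divides b exactly
    -- when each of the distinct primes does.
    S-÷ : ∀ w ps → All Prime ps → Unique ps → All (λ p → w ≤ fromℕ p) ps →
          S (𝒜 ÷ product ps) w ≡ length (filter (λ b → all? (_∣? b) ps) (filter (sifted? w) 𝒜))
    S-÷ w ps primes ups w≤ps = trans (sym (length-map (ℕ._* d) (filter (sifted? w) (𝒜 ÷ d))))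
      (unique-length
        (Unique.map⁺ (ℕ.*-cancelʳ-≡ _ _ d) (Unique.filter⁺ (sifted? w) (Unique-÷ 𝒜 d)))
        (Unique.filter⁺ (λ b → all? (_∣? b) ps) (Unique.filter⁺ (sifted? w) unique))
        to from)
      where
      d = product ps
      instance
        d≢0 : ℕ.NonZero d
        d≢0 = productOfPrimes≢0 primes

      to : ∀ {b} → b ∈ map (ℕ._* d) (filter (sifted? w) (𝒜 ÷ d)) →
           b ∈ filter (λ b → all? (_∣? b) ps) (filter (sifted? w) 𝒜)
      to b∈ with ∈-map⁻ (ℕ._* d) b∈
      ... | a , a∈ , refl with ∈-filter⁻ (sifted? w) {xs = 𝒜 ÷ d} a∈
      ... | a∈÷ , sifted = ∈-filter⁺ (λ b → all? (_∣? b) ps)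
        (∈-filter⁺ (sifted? w) (proj₂ (Equivalence.to (∈-÷ {𝒜} {d}) a∈÷)) sifted′)
        (product∣⇒All∣ ps (n∣m*n a))
        where
        sifted′ : Sifted w (a ℕ.* d)
        sifted′ (p , pp , p∣ad , p<w) with euclidsLemma a d pp p∣ad
        ... | inj₁ p∣a = sifted (p , pp , p∣a , p<w)
        ... | inj₂ p∣d = <-irrefl {fromℕ p} (<-≤-trans {fromℕ p} {w} {fromℕ p} p<w
          (All.lookup w≤ps (factorisationHasAllPrimeFactors pp p∣d primes)))

      from : ∀ {b} → b ∈ filter (λ b → all? (_∣? b) ps) (filter (sifted? w) 𝒜) →
             b ∈ map (ℕ._* d) (filter (sifted? w) (𝒜 ÷ d))
      from b∈ with ∈-filter⁻ (λ b → all? (_∣? b) ps) {xs = filter (sifted? w) 𝒜} b∈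
      ... | b∈′ , ps∣b with ∈-filter⁻ (sifted? w) {xs = 𝒜} b∈′ | All∣⇒product∣ primes ups ps∣b
      ... | b∈𝒜 , sifted | divides a refl = ∈-map⁺ (ℕ._* d) (∈-filter⁺ (sifted? w)
        -- The cofactor a is positive because b = a d is.
        (Equivalence.from (∈-÷ {𝒜} {d}) (a>0 a (All.lookup positive b∈𝒜) , b∈𝒜))
        (λ (p , pp , p∣a , p<w) → sifted (p , pp , ∣m⇒∣m*n d p∣a , p<w)))
        where
        a>0 : ∀ a → 0 ℕ.< a ℕ.* d → 0 ℕ.< a
        a>0 (suc _) _ = ℕ.z<s

    module _ (w z : ℝ) where

      private
        ν : ℕ → ℕ
        ν = ω w z

      -- Each b sifted by w is counted once for every r-tuple of primes in the range that all divide
      -- it, hence once for every r-subset of its `ν b` prime divisors there.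
      ∑S-ω : ∀ r → ∑S r 𝒜 w z ≡ sum (map (λ b → ν b C r) (filter (sifted? w) 𝒜))
      ∑S-ω r = begin
        sum (map (λ ps → S (𝒜 ÷ product ps) w) (choose r P))
          ≡⟨ sum-map-cong (choose r P) (λ {ps} ps∈ →
               let ps⊆P = ∈-choose⇒⊆ r P ps∈ in
               S-÷ w ps (All-resp-⊆ ps⊆P (All.map proj₁ inP)) (Unique-resp-⊆ ps⊆P uP)
                 (All-resp-⊆ ps⊆P (All.map (λ h → proj₁ (proj₂ h)) inP))) ⟩
        sum (map (λ ps → length (filter (λ b → all? (_∣? b) ps) B)) (choose r P))
          ≡⟨ double-counting (λ ps b → all? (_∣? b) ps) (choose r P) B ⟩
        sum (map (λ b → length (filter (all? (_∣? b)) (choose r P))) B)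
          ≡⟨ sum-map-cong B (λ {b} _ → trans (cong length (filter-choose (_∣? b) r P))
               (length-choose r (primeDivisors w z b))) ⟩
        sum (map (λ b → ν b C r) B) ∎
        where
        open ≡-Reasoning
        P = primes[ w , z ⟩
        B = filter (sifted? w) 𝒜
        uP : Unique P
        uP = Unique.filter⁺ _ (Unique.upTo⁺ (bound z))
        inP : All (λ p → Prime p × w ≤ fromℕ p × fromℕ p < z) P
        inP = All.tabulate (Equivalence.to (∈-primes {w} {z}))

      S-ω : S 𝒜 w ≡ sum (map (λ b → ν b C 0) (filter (sifted? w) 𝒜))
      S-ω = sym (sum-map-1 (filter (sifted? w) 𝒜))

      -- Having no prime factor below z amounts to having none below w and none in [w, z).
      sum-isZero-ω : w ≤ z → sum (map (λ b → isZero (ν b)) (filter (sifted? w) 𝒜)) ≡ S 𝒜 z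
      sum-isZero-ω w≤z = trans (sum-isZero ν (filter (sifted? w) 𝒜)) (unique-length
        (Unique.filter⁺ (λ b → ν b ℕ.≟ 0) (Unique.filter⁺ (sifted? w) unique))
        (Unique.filter⁺ (sifted? z) unique) to from)
        where
        none : ∀ {b p} → ν b ≡ 0 → ¬ (p ∈ primeDivisors w z b)
        none {b} νb≡0 p∈ with primeDivisors w z b
        none {b} ()   (here _)  | _ ∷ _
        none {b} ()   (there _) | _ ∷ _

        to : ∀ {b} → b ∈ filter (λ b → ν b ℕ.≟ 0) (filter (sifted? w) 𝒜) →
             b ∈ filter (sifted? z) 𝒜
        to {b} b∈ with ∈-filter⁻ (λ b → ν b ℕ.≟ 0) {xs = filter (sifted? w) 𝒜} b∈
        ... | b∈′ , νb≡0 with ∈-filter⁻ (sifted? w) {xs = 𝒜} b∈′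
        ... | b∈𝒜 , sifted = ∈-filter⁺ (sifted? z) b∈𝒜 λ (p , pp , p∣b , p<z) →
          -- As b is sifted by w, p is not below w; so it lies in the range and would be counted by
          -- `ν b`.
          none νb≡0 (∈-filter⁺ (_∣? b) (Equivalence.from (∈-primes {w} {z})
            (pp , ≮⇒≥ {fromℕ p} {w} (λ p<w → sifted (p , pp , p∣b , p<w)) , p<z)) p∣b)

        from : ∀ {b} → b ∈ filter (sifted? z) 𝒜 →
               b ∈ filter (λ b → ν b ℕ.≟ 0) (filter (sifted? w) 𝒜)
        from {b} b∈ with ∈-filter⁻ (sifted? z) {xs = 𝒜} b∈
        ... | b∈𝒜 , sifted = ∈-filter⁺ (λ b → ν b ℕ.≟ 0) (∈-filter⁺ (sifted? w) b∈𝒜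
          (λ (p , pp , p∣b , p<w) → sifted (p , pp , p∣b , <-≤-trans {fromℕ p} {w} {z} p<w w≤z)))
          (cong length (filter-none (_∣? b) (All.tabulate λ {p} p∈ p∣b →
            let pp , _ , p<z = Equivalence.to (∈-primes {w} {z}) p∈ in sifted (p , pp , p∣b , p<z))))

-- Summation of the weights over the integers sifted by w

theorem6 :
  (em : ExcludedMiddle 0ℓ) → let open Sieve em in
  (𝒜 : List ℕ) → Unique 𝒜 → All (0 ℕ.<_) 𝒜 →
  (w z : ℝ) → w ≤ z →
  (m₀ m₁ m₂ m₃ m₄ : ℝ) →
  (0<m₀ : 0ℝ < m₀) → m₀ ≤ 1ℝ →
  (u₁₂ : 𝒰 m₁ m₂) → (u₃₄ : 𝒰 m₃ m₄) →
  let N₅ : ℕ → ℝ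
      N₅ r = N^ r (m₀ ∷ m₁ ∷ m₂ ∷ m₃ ∷ m₄ ∷ [])
      Q : ℝ
      Q = m₀ * m₁ * m₂ * m₃ * m₄
      Q>0 : 0ℝ < Q
      Q>0 = Q-positive {m₀} {m₁} {m₂} {m₃} {m₄} 0<m₀ u₁₂ u₃₄
      _/Q : ℝ → ℝ
      x /Q = x * recip Q Q>0
      # : ℕ → ℝ
      # = fromℕ
  in
  # (S 𝒜 w)
    - ((N₅ 4 - N₅ 3 + N₅ 2 - N₅ 1 + # 1) /Q) * # (∑S 1 𝒜 w z)
    + ((# 2 * (N₅ 3 - # 3 * N₅ 2 + # 7 * N₅ 1 - # 15)) /Q) * # (∑S 2 𝒜 w z)
    - ((# 6 * (N₅ 2 - # 6 * N₅ 1 + # 25)) /Q) * # (∑S 3 𝒜 w z)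
    + ((# 24 * (N₅ 1 - # 10)) /Q) * # (∑S 4 𝒜 w z)
    - (# 120 /Q) * # (∑S 5 𝒜 w z)
  ≤ # (S 𝒜 z)
theorem6 em 𝒜 unique positive w z w≤z m₀ m₁ m₂ m₃ m₄ 0<m₀ m₀≤1 u₁₂ u₃₄ =
  -- `L counts` unfolds to the left-hand side. From the inside out: bound each weight by `isZero`,
  -- sum over `B`, identify the six counts, and recognise the total as `S 𝒜 z`.
  subst (λ s → L counts ≤ fromℕ s) (sum-isZero-ω unique positive w z w≤z)
    (L-cong {counts} {x = fromℕ (sum (map (λ b → isZero (ω′ b)) B))} counts≗
      (L-sum (λ r b → ω′ b C r) (λ b → isZero (ω′ b)) (λ b → L-binomial (ω′ b)) B))
  where
  open Sieve em
  open SieveIdentities em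
  open Weight {m₀} {m₁} {m₂} {m₃} {m₄} 0<m₀ m₀≤1 u₁₂ u₃₄

  B : List ℕ
  B = filter (sifted? w) 𝒜

  ω′ : ℕ → ℕ
  ω′ = ω w z

  counts : ℕ → ℕ
  -- The leading term is `S 𝒜 w` itself; `∑S 0` would give `S (𝒜 ÷ 1) w`.
  counts zero    = S 𝒜 w
  counts (suc r) = ∑S (suc r) 𝒜 w z

  counts≗ : ∀ r → counts r ≡ sum (map (λ b → ω′ b C r) B)
  counts≗ zero    = S-ω unique positive w z
  counts≗ (suc r) = ∑S-ω unique positive w z (suc r)
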